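{- Let $n\ge 2$ be an integer and $\varepsilon>0$ a real number. There is a constant $C>0$ depending only on $n$ and $\varepsilon$ such that for every integer $k\ge1$, the probability that a matrix chosen uniformly at random from $\mathcal{M}_n(k)$ has at least one integer eigenvalue is at most $C/k^{1-\varepsilon}$. In particular, for every integer $k\ge 1$ the probability that a matrix chosen uniformly at random from $\mathcal{M}_n(k)$ is diagonalizable over $\mathbb{Q}$ is at most $C/k^{1-\varepsilon}$.
   Context: For an integer $k\ge1$, let $\mathcal{I}_k=\{ -k,-k+1,\dots,k-1,k\}$, and let $\mathcal{M}_n(k)$ be the set of all $n\times n$ matrices all of whose entries lie in $\mathcal{I}_k$; it has $(2k+1)^{n^2}$ elements. "Chosen uniformly at random" means each matrix in $\mathcal{M}_n(k)$ has probability $(2k+1)^{ -n^2}$, i.e. each entry is chosen independently and uniformly from $\mathcal{I}_k$. -}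

module Defs where

open import Data.Nat as ℕ using (ℕ; zero; suc)
open import Data.Integer as ℤ using (ℤ; +_; -_)
open import Data.Rational as ℚ using (ℚ; 0ℚ; 1ℚ; _/_)
open import Data.Fin using (Fin; zero; suc; _≟_)
open import Data.Vec using (Vec; []; _∷_; map; zipWith; foldr; tabulate; lookup; replicate)
open import Data.Vec.Relation.Unary.All using (All)
open import Data.Product using (Σ; _×_; ∃)
open import Relation.Binary.PropositionalEquality using (_≡_; _≢_)
open import Relation.Nullary using (yes; no)

-- n × n matrices over a type A, as a vector of rows
Mat : Set → ℕ → Set
Mat A n = Vec (Vec A n) n

InI : ℕ → ℤ → Set
InI k x = (- (+ k)) ℤ.≤ x × x ℤ.≤ + k

InM : (n k : ℕ) → Mat ℤ n → Set
InM n k A = All (All (InI k)) A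

toℚ : ℤ → ℚ
toℚ z = z / 1

toℚMat : ∀ {n} → Mat ℤ n → Mat ℚ n
toℚMat = map (map toℚ)

sumℚ : ∀ {m} → Vec ℚ m → ℚ
sumℚ = foldr _ ℚ._+_ 0ℚ

dotℚ : ∀ {m} → Vec ℚ m → Vec ℚ m → ℚ
dotℚ u v = sumℚ (zipWith ℚ._*_ u v)

_·ᵥ_ : ∀ {n} → Mat ℚ n → Vec ℚ n → Vec ℚ n
M ·ᵥ v = map (λ row → dotℚ row v) M

_·ₘ_ : ∀ {n} → Mat ℚ n → Mat ℚ n → Mat ℚ n
M ·ₘ N = tabulate λ i → tabulate λ j →
  dotℚ (lookup M i) (tabulate λ l → lookup (lookup N l) j)

diagℚ : ∀ {n} → Vec ℚ n → Mat ℚ n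
diagℚ d = tabulate λ i → tabulate λ j → diagEntry i j
  where
  diagEntry : _ → _ → ℚ
  diagEntry i j with i ≟ j
  ... | yes _ = lookup d i
  ... | no  _ = 0ℚ

Iℚ : ∀ {n} → Mat ℚ n
Iℚ = diagℚ (replicate _ 1ℚ)

IsEigenvalue : ∀ {n} → Mat ℤ n → ℚ → Set
IsEigenvalue {n} A λ' =
  Σ (Vec ℚ n) λ v → (v ≢ replicate n 0ℚ) × (toℚMat A ·ᵥ v ≡ map (λ' ℚ.*_) v)

HasIntEigenvalue : ∀ {n} → Mat ℤ n → Set
HasIntEigenvalue A = ∃ λ (m : ℤ) → IsEigenvalue A (toℚ m)

DiagonalizableQ : ∀ {n} → Mat ℤ n → Set
DiagonalizableQ {n} A =
  Σ (Mat ℚ n) λ P → Σ (Mat ℚ n) λ Q → Σ (Vec ℚ n) λ d →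
    (P ·ₘ Q ≡ Iℚ) × (Q ·ₘ P ≡ Iℚ) × (Q ·ₘ (toℚMat A ·ₘ P) ≡ diagℚ d)

{-# OPTIONS --safe #-}
-- An integer eigenvalue μ of a matrix in M_n(k) satisfies |μ| ≤ nk, so it suffices to bound, for each such μ, the
-- number of A with A - μ singular by O(k^(n²-2+ε)). Write A - μ = [X U; V D] with X of size 2 × 2. If D is singular
-- we conclude by induction on n (from n - 2 to n). Otherwise fraction-free elimination of the last n - 2 coordinates
-- of a kernel vector turns the 2 × 2 Schur complement into an equation
--   (δx + c₁)(δw + c₄) = (δy + c₂)(δz + c₃)
-- with integers δ ≠ 0 and cᵢ bounded by a power of k, all determined by U, V and D. If the right-hand side is nonzero,
-- then δx + c₁ is one of its O(k^ε) divisors, and x determines w; the vanishing case loses two coordinates outright.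
-- For n = 3 the induction hypothesis is not strong enough, but a₃₃ = μ leaves a determinant that is affine in a₁₁.
-- A matrix diagonalizable over ℚ has a rational eigenvalue, and its denominator is 1 by infinite descent.
module Submission where

open import Defs
open import Data.Nat as ℕ using (ℕ; zero; suc; _≤_; z≤n; s≤s)
import Data.Nat.Properties as ℕₚ
open import Data.Integer as ℤ using (ℤ)
import Data.Integer.Properties as ℤₚ
open import Data.Fin as Fin using (Fin; zero; suc)
open import Data.Vec as Vec using (Vec; []; _∷_; lookup; tabulate; replicate)
import Data.Vec.Properties as Vecₚ
import Data.Vec.Relation.Unary.All as VAll
import Data.Vec.Relation.Unary.All.Properties as VAllₚ
open import Data.Product using (Σ; _×_; _,_; proj₁; proj₂; ∃)
open import Data.Product.Properties using () renaming (≡-dec to ×-≡-dec)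
open import Data.Sum using (_⊎_; inj₁; inj₂; [_,_]′)
open import Function using (_∘_; case_of_)
open import Relation.Nullary using (Dec; ¬_; yes; no; ¬?; contradiction)
open import Relation.Nullary.Decidable using (decidable-stable)
open import Relation.Binary.Definitions using (DecidableEquality)
open import Relation.Binary.PropositionalEquality

-- A union bound over the O(k) candidates μ costs a factor k, so singularity of A - μ, a single
-- equation, has to be as rare as two independent conditions. Solving an affine equation for one
-- entry gains only one of them. The second comes from the product form of the 2 × 2 equation: a
-- nonzero integer of polynomial size has few factorisations. This is the only source of ε; every
-- other step loses a constant. The size of the integer only has to be polynomial in k, since its
-- number of divisors lies below every positive power of it, so crude bounds on the elimination
-- suffice. A singular D cannot be eliminated, but then μ is an eigenvalue of D itself, and the
-- induction is applied with the same μ. When D has size 1 this is just one condition, which is why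
-- size 3 needs its own argument. The exponent ε is the fraction p/q, and all estimates are compared
-- after raising them to the power q, so that only natural numbers occur.

-- Counting by duplicate-free lists

module Counting where
  open import Data.Nat using (_<_; _+_; _*_; _^_)
  open import Data.Integer using (+_; -[1+_]; ∣_∣)
  open import Data.List as List using (List; []; _∷_; length)
  open import Data.List.Membership.Propositional using (_∈_)
  open import Data.List.Membership.Propositional.Properties using (∈-map⁺; ∈-map⁻; ∈-deduplicate⁺; ∈-deduplicate⁻; ∈-upTo⁺)
  open import Data.List.Properties using (length-map; length-upTo)
  open import Data.List.Relation.Unary.Any using (here; there)
  open import Data.List.Relation.Unary.All as All using (All; []; _∷_)
  import Data.List.Relation.Unary.All.Properties as Allₚ
  open import Data.List.Relation.Unary.AllPairs using ([]; _∷_)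
  open import Data.List.Relation.Unary.Unique.Propositional using (Unique)
  import Data.List.Relation.Unary.Unique.DecPropositional.Properties as UniqueDec

  infix 4 _≲_

  -- Bounding all duplicate-free lists gives a cardinality bound for predicates that are neither
  -- decided nor enumerated, such as having an eigenvalue.
  _≲_ : {A : Set} → (A → Set) → ℕ → Set
  P ≲ N = ∀ L → Unique L → All P L → length L ≤ N

  module _ {A : Set} where

    ≲-mono : {P Q : A → Set} {M N : ℕ} → (∀ {a} → P a → Q a) → M ≤ N → Q ≲ M → P ≲ N
    ≲-mono P⊆Q M≤N Q≲M L u ps = ℕₚ.≤-trans (Q≲M L u (All.map P⊆Q ps)) M≤N

    ≲-none : {P : A → Set} → (∀ {a} → ¬ P a) → P ≲ 0
    ≲-none ¬P [] u ps = z≤n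
    ≲-none ¬P (x ∷ L) u (p ∷ ps) = contradiction p ¬P

    -- The two functions at the end stand for both parts being sublists of `L`. The recursion uses
    -- them to carry the freshness of the head over to the part that the head joins.
    split-list : {P Q : A → Set} → ∀ L → Unique L → All (λ a → P a ⊎ Q a) L →
      ∃ λ L₁ → ∃ λ L₂ → Unique L₁ × Unique L₂ × All P L₁ × All Q L₂ ×
        length L ≡ length L₁ + length L₂ ×
        (∀ {R : A → Set} → All R L → All R L₁) × (∀ {R : A → Set} → All R L → All R L₂)
    split-list [] u ps = [] , [] , [] , [] , [] , [] , refl , (λ _ → []) , (λ _ → [])
    split-list (x ∷ L) (x∉ ∷ u) (px ∷ ps) with split-list L u ps
    ... | L₁ , L₂ , u₁ , u₂ , p₁ , p₂ , eq , r₁ , r₂ with px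
    ... | inj₁ p = x ∷ L₁ , L₂ , r₁ x∉ ∷ u₁ , u₂ , p ∷ p₁ , p₂ , cong suc eq ,
                   (λ { (r ∷ rs) → r ∷ r₁ rs }) , (λ { (r ∷ rs) → r₂ rs })
    ... | inj₂ q = L₁ , x ∷ L₂ , u₁ , r₂ x∉ ∷ u₂ , p₁ , q ∷ p₂ ,
                   trans (cong suc eq) (sym (ℕₚ.+-suc (length L₁) (length L₂))) ,
                   (λ { (r ∷ rs) → r₁ rs }) , (λ { (r ∷ rs) → r ∷ r₂ rs })

    ≲-union : {P Q R : A → Set} {M N : ℕ} → (∀ {a} → P a → Q a ⊎ R a) → Q ≲ M → R ≲ N → P ≲ M + N
    ≲-union split Q≲M R≲N L u ps with split-list L u (All.map split ps)
    ... | L₁ , L₂ , u₁ , u₂ , p₁ , p₂ , eq , _ =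
      subst (_≤ _) (sym eq) (ℕₚ.+-mono-≤ (Q≲M L₁ u₁ p₁) (R≲N L₂ u₂ p₂))

    ≲-⋃ : {B : Set} {P : A → Set} {R : B → A → Set} {N : ℕ} (bs : List B) →
      (∀ {a} → P a → ∃ λ b → b ∈ bs × R b a) → (∀ {b} → b ∈ bs → R b ≲ N) → P ≲ length bs * N
    ≲-⋃ [] cover R≲N = ≲-none λ p → case cover p of λ { (_ , () , _) }
    ≲-⋃ {P = P} {R} (b ∷ bs) cover R≲N =
      ≲-union {Q = R b} {R = λ a → ∃ λ b → b ∈ bs × R b a}
        (λ p → split (cover p)) (R≲N (here refl)) (≲-⋃ bs (λ r → r) (λ b∈ → R≲N (there b∈)))
      where
      split : ∀ {a} → (∃ λ c → c ∈ b ∷ bs × R c a) → R b a ⊎ (∃ λ c → c ∈ bs × R c a)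
      split (_ , here refl , r) = inj₁ r
      split (c , there c∈ , r) = inj₂ (c , c∈ , r)

    ≲-1 : {P : A → Set} → (∀ {a b} → P a → P b → a ≡ b) → P ≲ 1
    ≲-1 eq [] u ps = z≤n
    ≲-1 eq (x ∷ []) u ps = s≤s z≤n
    ≲-1 eq (x ∷ y ∷ L) ((x≢y ∷ _) ∷ u) (p ∷ q ∷ ps) = contradiction (eq p q) x≢y

  module _ {A B : Set} (_≟_ : DecidableEquality B) (f : A → B) where

    ≲-fiber : {P : A → Set} {Q : B → Set} {M N : ℕ} → (∀ {a} → P a → Q (f a)) → Q ≲ M →
      (∀ b → Q b → (λ a → P a × f a ≡ b) ≲ N) → P ≲ M * N
    ≲-fiber {P} {Q} {M} {N} fP Q≲M fib L u ps = ℕₚ.≤-trans len (ℕₚ.*-monoˡ-≤ N (Q≲M bs bs! bsQ))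
      where
      bs = List.deduplicate _≟_ (List.map f L)
      bs! = UniqueDec.deduplicate-! _≟_ (List.map f L)
      inQ : ∀ {b} → b ∈ bs → Q b
      inQ b∈ with ∈-map⁻ f (∈-deduplicate⁻ _≟_ (List.map f L) b∈)
      ... | a , a∈ , refl = fP (All.lookup ps a∈)
      bsQ : All Q bs
      bsQ = All.tabulate inQ
      -- Membership in `L` joins the predicate because `bs` lists the images of members of `L` only.
      len : length L ≤ length bs * N
      len = ≲-⋃ {P = λ a → P a × a ∈ L} {R = λ b a → P a × f a ≡ b} bs
              (λ { {a} (p , a∈) → f a , ∈-deduplicate⁺ _≟_ (∈-map⁺ f a∈) , p , refl })
              (λ b∈ → fib _ (inQ b∈)) L u (All.tabulate λ a∈ → All.lookup ps a∈ , a∈)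

    ≲-inj : {P : A → Set} {Q : B → Set} {M : ℕ} → (∀ {a} → P a → Q (f a)) →
      (∀ {a b} → P a → P b → f a ≡ f b → a ≡ b) → Q ≲ M → P ≲ M
    ≲-inj {P} fP inj Q≲M = ≲-mono (λ p → p) (ℕₚ.≤-reflexive (ℕₚ.*-identityʳ _))
      (≲-fiber {P} fP Q≲M λ b _ → ≲-1 λ { (p , e) (p' , e') → inj p p' (trans e (sym e')) })

  module _ {A B : Set} (_≟_ : DecidableEquality A) where

    ≲-Σ : {P : A → Set} {Q : A → B → Set} {M N : ℕ} → P ≲ M → (∀ a → P a → Q a ≲ N) →
      (λ (ab : A × B) → P (proj₁ ab) × Q (proj₁ ab) (proj₂ ab)) ≲ M * N
    ≲-Σ {P} {Q} P≲M Q≲N = ≲-fiber _≟_ proj₁ proj₁ P≲M λ a pa →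
      λ L u ps → subst (_≤ _) (length-map proj₂ L)
        (Q≲N a pa (List.map proj₂ L) (uniq a L u ps) (Allₚ.map⁺ (All.map (λ { ((p , q) , refl) → q }) ps)))
      where
      uniq : ∀ a L → Unique L → All (λ ab → (P (proj₁ ab) × Q (proj₁ ab) (proj₂ ab)) × proj₁ ab ≡ a) L →
             Unique (List.map proj₂ L)
      uniq a [] u ps = []
      uniq a ((x , y) ∷ L) (x∉ ∷ u) ((_ , refl) ∷ ps) =
        Allₚ.map⁺ (All.zipWith (λ { {x' , y'} (ne , (_ , refl)) refl → ne refl }) (x∉ , ps)) ∷ uniq a L u ps

    ≲-× : {P : A → Set} {Q : B → Set} {M N : ℕ} → P ≲ M → Q ≲ N →
      (λ (ab : A × B) → P (proj₁ ab) × Q (proj₂ ab)) ≲ M * N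
    ≲-× P≲M Q≲N = ≲-Σ P≲M (λ _ _ → Q≲N)

  ≲-Vec : {A : Set} (_≟_ : DecidableEquality A) {P : A → Set} {N : ℕ} → P ≲ N →
    ∀ n → VAll.All P {n} ≲ N ^ n
  ≲-Vec _≟_ P≲N zero = ≲-1 λ { {[]} {[]} _ _ → refl }
  ≲-Vec {A} _≟_ {P} P≲N (suc n) = ≲-inj dec (λ { (x ∷ xs) → x , xs })
      (λ { (p VAll.∷ ps) → p , ps }) (λ { {x ∷ xs} {y ∷ ys} _ _ refl → refl })
      (≲-× _≟_ P≲N (≲-Vec _≟_ P≲N n))
    where
    dec = ×-≡-dec _≟_ (Vecₚ.≡-dec _≟_)

  ≲-list : {A : Set} {P : A → Set} (l : List A) → (∀ {a} → P a → a ∈ l) → P ≲ length l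
  ≲-list l P⊆l = ≲-mono (λ p → p) (ℕₚ.≤-reflexive (ℕₚ.*-identityʳ _))
    (≲-⋃ {R = λ b a → a ≡ b} l (λ {a} p → a , P⊆l p , refl) (λ _ → ≲-1 λ { refl refl → refl }))

  interval : ℕ → List ℤ
  interval k = List.map (λ j → + j ℤ.- + k) (List.upTo (1 + 2 * k))

  length-interval : ∀ k → length (interval k) ≡ 1 + 2 * k
  length-interval k = trans (length-map _ (List.upTo (1 + 2 * k))) (length-upTo (1 + 2 * k))

  InI⇒∈interval : ∀ {k x} → InI k x → x ∈ interval k
  InI⇒∈interval {k} {x} (lo , hi) = subst (_∈ interval k) back (∈-map⁺ (λ j → + j ℤ.- + k) (∈-upTo⁺ below))
    where
    +∣x+k∣ : + ∣ x ℤ.+ + k ∣ ≡ x ℤ.+ + k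
    +∣x+k∣ = ℤₚ.0≤i⇒+∣i∣≡i (subst (ℤ._≤ x ℤ.+ + k) (ℤₚ.+-inverseˡ (+ k)) (ℤₚ.+-monoˡ-≤ (+ k) lo))
    below : ∣ x ℤ.+ + k ∣ < 1 + 2 * k
    below = s≤s (ℤₚ.drop‿+≤+ (subst₂ ℤ._≤_ (sym +∣x+k∣)
      (cong (λ m → + (k + m)) (sym (ℕₚ.+-identityʳ k))) (ℤₚ.+-monoˡ-≤ (+ k) hi)))
    back : + ∣ x ℤ.+ + k ∣ ℤ.- + k ≡ x
    back = trans (cong (ℤ._- + k) +∣x+k∣) (trans (ℤₚ.+-assoc x (+ k) (ℤ.- + k))
      (trans (cong (λ t → x ℤ.+ t) (ℤₚ.+-inverseʳ (+ k))) (ℤₚ.+-identityʳ x)))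

  InI-≲ : ∀ k → InI k ≲ 1 + 2 * k
  InI-≲ k = subst (InI k ≲_) (length-interval k) (≲-list (interval k) InI⇒∈interval)

  ∣∣≤⇒InI : ∀ {k x} → ∣ x ∣ ≤ k → InI k x
  ∣∣≤⇒InI {k} {+ n} le = ℤₚ.≤-trans (ℤₚ.neg-≤-pos {k} {0}) (ℤ.+≤+ z≤n) , ℤ.+≤+ le
  ∣∣≤⇒InI {k} { -[1+ n ]} le = ℤₚ.neg-mono-≤ (ℤ.+≤+ le) , ℤ.-≤+

  InI⇒∣∣≤ : ∀ {k x} → InI k x → ∣ x ∣ ≤ k
  InI⇒∣∣≤ {x = + n} (_ , ℤ.+≤+ hi) = hi
  InI⇒∣∣≤ {k} { -[1+ n ]} (lo , _) = ℤₚ.drop‿+≤+ (ℤₚ.neg-cancel-≤ lo)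

open Counting

-- The divisor bound: the number of divisors of N is O(N^(1/s)) for every s

module DivisorBound where
  open import Data.Nat
  open import Data.Nat.Properties hiding (_≟_)
  open import Data.Nat.Divisibility
  open import Data.Nat.DivMod using (_/_; _%_; m≡m%n+[m/n]*n; m%n<n; m*n/n≡m; m/n*n≤m)
  open import Data.Nat.Coprimality using (Coprime; coprime-divisor)
  open import Data.Nat.Primality using (Prime; _Rough_; rough⇒≤; ∤⇒rough-suc; rough∧∣⇒rough; rough∧∣⇒prime; prime⇒irreducible; prime⇒nonZero; 2-rough)
  open import Data.Nat.Induction using (<-rec)
  open import Data.Nat.Tactic.RingSolver using (solve-∀)

  ^-distribʳ-* : ∀ m n o → (m * n) ^ o ≡ m ^ o * n ^ o
  ^-distribʳ-* m n zero = refl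
  ^-distribʳ-* m n (suc o) = trans (cong (m * n *_) (^-distribʳ-* m n o)) (eq m n (m ^ o) (n ^ o))
    where
    eq : ∀ a b c d → a * b * (c * d) ≡ a * c * (b * d)
    eq = solve-∀

  ^-cancelʳ-≤ : ∀ {m n} o → 1 ≤ o → m ^ o ≤ n ^ o → m ≤ n
  ^-cancelʳ-≤ {m} {n} o@(suc _) 1≤o m^o≤n^o with m ≤? n
  ... | yes m≤n = m≤n
  ... | no m≰n = contradiction (<-≤-trans (^-monoˡ-< o (≰⇒> m≰n)) m^o≤n^o) (<-irrefl refl)

  1≤^ : ∀ {m} o → 1 ≤ m → 1 ≤ m ^ o
  1≤^ {suc m} o _ = m^n>0 (suc m) o

  1+a≤2^a : ∀ a → suc a ≤ 2 ^ a
  1+a≤2^a zero = ≤-refl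
  1+a≤2^a (suc a) = begin
    suc (suc a) ≤⟨ +-mono-≤ (1≤^ {2} a (s≤s z≤n)) (1+a≤2^a a) ⟩
    2 ^ a + 2 ^ a ≡⟨ cong (2 ^ a +_) (sym (+-identityʳ _)) ⟩
    2 ^ suc a ∎
    where open ≤-Reasoning

  -- Division with remainder by s gives a + 1 ≤ s (a/s + 1) ≤ s 2^(a/s) with the integer quotient
  -- a/s; the factor s^s appears on taking s-th powers.
  pow≤exp : ∀ s → 1 ≤ s → ∀ a → suc a ^ s ≤ s ^ s * 2 ^ a
  pow≤exp s@(suc _) _ a = begin
    suc a ^ s ≤⟨ ^-monoˡ-≤ s a+1≤ ⟩
    (s * 2 ^ (a / s)) ^ s ≡⟨ ^-distribʳ-* s (2 ^ (a / s)) s ⟩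
    s ^ s * (2 ^ (a / s)) ^ s ≡⟨ cong (s ^ s *_) (^-*-assoc 2 (a / s) s) ⟩
    s ^ s * 2 ^ (a / s * s) ≤⟨ *-monoʳ-≤ (s ^ s) (^-monoʳ-≤ 2 (m/n*n≤m a s)) ⟩
    s ^ s * 2 ^ a ∎
    where
    open ≤-Reasoning
    a+1≤ : suc a ≤ s * 2 ^ (a / s)
    a+1≤ = begin
      suc a ≡⟨ cong suc (m≡m%n+[m/n]*n a s) ⟩
      suc (a % s) + (a / s) * s ≤⟨ +-monoˡ-≤ _ (m%n<n a s) ⟩
      s + (a / s) * s ≡⟨ *-comm (suc (a / s)) s ⟩
      s * suc (a / s) ≤⟨ *-monoʳ-≤ s (1+a≤2^a (a / s)) ⟩
      s * 2 ^ (a / s) ∎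

  pow≤big-exp : ∀ s a b → 2 ^ s ≤ b → suc a ^ s ≤ b ^ a
  pow≤big-exp s a b 2^s≤b = begin
    suc a ^ s ≤⟨ ^-monoˡ-≤ s (1+a≤2^a a) ⟩
    (2 ^ a) ^ s ≡⟨ ^-*-assoc 2 a s ⟩
    2 ^ (a * s) ≡⟨ cong (2 ^_) (*-comm a s) ⟩
    2 ^ (s * a) ≡⟨ sym (^-*-assoc 2 s a) ⟩
    (2 ^ s) ^ a ≤⟨ ^-monoˡ-≤ a 2^s≤b ⟩
    b ^ a ∎
    where open ≤-Reasoning

  ∤⇒coprime : ∀ {p d} → Prime p → ¬ p ∣ d → Coprime d p
  ∤⇒coprime pp p∤d (e∣d , e∣p) with prime⇒irreducible pp e∣p
  ... | inj₁ e≡1 = e≡1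
  ... | inj₂ refl = contradiction e∣d p∤d

  coprime-divisor-^ : ∀ {p d n} → Prime p → ¬ p ∣ d → ∀ a → d ∣ p ^ a * n → d ∣ n
  coprime-divisor-^ {n = n} pp p∤d zero d∣ = subst (_ ∣_) (+-identityʳ n) d∣
  coprime-divisor-^ {p} {d} {n} pp p∤d (suc a) d∣ = coprime-divisor-^ pp p∤d a
    (coprime-divisor (∤⇒coprime pp p∤d) (subst (d ∣_) (*-assoc p (p ^ a) n) d∣))

  -- A divisor of p^(a+1) n that p does not divide already divides n; any other becomes a divisor of
  -- p^a n after division by p. Each power of p therefore adds at most t.
  divisors-^ : ∀ {p n t} → Prime p → (_∣ n) ≲ t → ∀ a → (_∣ p ^ a * n) ≲ suc a * t
  divisors-^ {n = n} {t} pp n≲t zero =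
    ≲-mono (subst (_ ∣_) (+-identityʳ n)) (≤-reflexive (sym (+-identityʳ t))) n≲t
  divisors-^ {p} {n} {t} pp n≲t (suc a) = ≲-union split n≲t
      (≲-inj ℕₚ._≟_ (_/ p) {Q = _∣ p ^ a * n} quot inj (divisors-^ pp n≲t a))
    where
    instance _ = prime⇒nonZero pp
    split : ∀ {d} → d ∣ p ^ suc a * n → d ∣ n ⊎ (d ∣ p ^ suc a * n × p ∣ d)
    split {d} d∣ with p ∣? d
    ... | yes p∣d = inj₂ (d∣ , p∣d)
    ... | no p∤d = inj₁ (coprime-divisor-^ pp p∤d (suc a) d∣)
    quot : ∀ {d} → d ∣ p ^ suc a * n × p ∣ d → d / p ∣ p ^ a * n
    quot (d∣ , divides-refl q) = subst (_∣ p ^ a * n) (sym (m*n/n≡m q p))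
      (*-cancelˡ-∣ p (subst₂ _∣_ (*-comm q p) (*-assoc p (p ^ a) n) d∣))
    inj : ∀ {d e} → d ∣ p ^ suc a * n × p ∣ d → e ∣ p ^ suc a * n × p ∣ e → d / p ≡ e / p → d ≡ e
    inj (_ , divides-refl q) (_ , divides-refl r) eq =
      cong (_* p) (trans (sym (m*n/n≡m q p)) (trans eq (m*n/n≡m r p)))

  record Split (p N : ℕ) : Set where
    field
      a n : ℕ
      eq : N ≡ p ^ a * n
      p∤n : ¬ p ∣ n

  split-off : ∀ p → 2 ≤ p → ∀ N → 1 ≤ N → Split p N
  split-off p 2≤p = <-rec (λ N → 1 ≤ N → Split p N) go
    where
    go : ∀ N → (∀ {M} → M < N → 1 ≤ M → Split p M) → 1 ≤ N → Split p N
    go N rec 1≤N with p ∣? N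
    ... | no p∤N = record { a = 0 ; n = N ; eq = sym (+-identityʳ N) ; p∤n = p∤N }
    ... | yes (divides-refl zero) = contradiction 1≤N λ ()
    ... | yes (divides-refl q@(suc _)) with rec {q} (m<m*n q p 2≤p) (s≤s z≤n)
    ... | record { a = a ; n = n ; eq = eq ; p∤n = p∤n } =
      record { a = suc a ; n = n ; eq = trans (*-comm q p) (trans (cong (p *_) eq) (sym (*-assoc p (p ^ a) n))) ; p∤n = p∤n }

  module _ (s : ℕ) (1≤s : 1 ≤ s) where

    private
      D = s ^ s
      1≤D : 1 ≤ D
      1≤D = 1≤^ s 1≤s

      mono-D : ∀ b → D ^ (2 ^ s ∸ suc b) ≤ D ^ (2 ^ s ∸ b)
      mono-D b = ^-monoʳ-≤ D {{>-nonZero 1≤D}} (∸-monoʳ-≤ (2 ^ s) (n≤1+n b))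

      -- The exponent `2 ^ s ∸ b` reserves one factor `D` for each integer from b up to 2^s - 1.
      -- Passing from b to b + 1 below 2^s releases exactly one of them, which pays for `pow≤exp`;
      -- from 2^s on the truncated subtraction leaves nothing to spend.
      step-D : ∀ a b → 2 ≤ b → D ^ (2 ^ s ∸ suc b) * suc a ^ s ≤ D ^ (2 ^ s ∸ b) * b ^ a
      step-D a b 2≤b with 2 ^ s ≤? b
      ... | yes 2^s≤b = *-mono-≤ (mono-D b) (pow≤big-exp s a b 2^s≤b)
      ... | no 2^s≰b = begin
        D ^ (2 ^ s ∸ suc b) * suc a ^ s
          ≤⟨ *-monoʳ-≤ (D ^ (2 ^ s ∸ suc b)) (≤-trans (pow≤exp s 1≤s a) (*-monoʳ-≤ D (^-monoˡ-≤ a 2≤b))) ⟩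
        D ^ (2 ^ s ∸ suc b) * (D * b ^ a) ≡⟨ sym (*-assoc (D ^ (2 ^ s ∸ suc b)) D (b ^ a)) ⟩
        D ^ (2 ^ s ∸ suc b) * D * b ^ a ≡⟨ cong (_* b ^ a) (*-comm (D ^ (2 ^ s ∸ suc b)) D) ⟩
        D ^ suc (2 ^ s ∸ suc b) * b ^ a ≡⟨ cong (λ e → D ^ e * b ^ a) (sym (+-∸-assoc 1 (≰⇒> 2^s≰b))) ⟩
        D ^ (2 ^ s ∸ b) * b ^ a ∎
        where open ≤-Reasoning

    -- A prime b < 2^s of multiplicity a costs a factor s^s, as (a+1)^s ≤ s^s 2^a; a prime b ≥ 2^s costs nothing, as
    -- (a+1)^s ≤ 2^(as) ≤ b^a. The argument f is fuel for the search of the next prime.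
    rough-divisors : ∀ f b N → 2 ≤ b → 1 ≤ N → N < b + f → b Rough N →
      ∃ λ t → t ^ s ≤ D ^ (2 ^ s ∸ b) * N × (_∣ N) ≲ t
    rough-divisors f b 1 2≤b 1≤N N<b+f rough = 1 ,
      ≤-trans (≤-reflexive (^-zeroˡ s)) (≤-trans (1≤^ (2 ^ s ∸ b) 1≤D) (≤-reflexive (sym (*-identityʳ _)))) ,
      ≲-1 λ d e → trans (∣1⇒≡1 d) (sym (∣1⇒≡1 e))
    rough-divisors zero b N@(suc (suc _)) 2≤b 1≤N N<b rough =
      contradiction (<-≤-trans N<b (≤-trans (≤-reflexive (+-identityʳ b)) (rough⇒≤ rough))) (<-irrefl refl)
    rough-divisors (suc f) b N@(suc (suc _)) 2≤b 1≤N N<b+f rough with b ∣? N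
    ... | no b∤N with rough-divisors f (suc b) N (m≤n⇒m≤1+n 2≤b) 1≤N (subst (N <_) (+-suc b f) N<b+f) (∤⇒rough-suc b∤N rough)
    ... | t , t^s≤ , N≲t = t , ≤-trans t^s≤ (*-monoˡ-≤ N (mono-D b)) , N≲t
    -- Here b is prime, since a smaller nontrivial factor of b would divide N, against roughness.
    rough-divisors (suc f) b N@(suc (suc _)) 2≤b 1≤N N<b+f rough | yes b∣N with split-off b 2≤b N 1≤N
    ... | record { a = a ; n = zero ; eq = eq ; p∤n = b∤n } = contradiction (b ∣0) b∤n
    ... | record { a = a ; n = n@(suc _) ; eq = eq ; p∤n = b∤n }
        with rough-divisors f (suc b) n (m≤n⇒m≤1+n 2≤b) (s≤s z≤n)
               (≤-<-trans (∣⇒≤ n∣N) (subst (N <_) (+-suc b f) N<b+f)) (∤⇒rough-suc b∤n (rough∧∣⇒rough rough n∣N))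
      where
      n∣N : n ∣ N
      n∣N = divides (b ^ a) eq
    ... | t , t^s≤ , n≲t = suc a * t , bound ,
        subst (λ M → (_∣ M) ≲ suc a * t) (sym eq) (divisors-^ (rough∧∣⇒prime {{n>1⇒nonTrivial 2≤b}} rough b∣N) n≲t a)
      where
      open ≤-Reasoning
      reorder₁ : ∀ x y z → x * (y * z) ≡ (y * x) * z
      reorder₁ = solve-∀
      bound : (suc a * t) ^ s ≤ D ^ (2 ^ s ∸ b) * N
      bound = begin
        (suc a * t) ^ s ≡⟨ ^-distribʳ-* (suc a) t s ⟩
        suc a ^ s * t ^ s ≤⟨ *-monoʳ-≤ (suc a ^ s) t^s≤ ⟩
        suc a ^ s * (D ^ (2 ^ s ∸ suc b) * n) ≡⟨ reorder₁ (suc a ^ s) (D ^ (2 ^ s ∸ suc b)) n ⟩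
        D ^ (2 ^ s ∸ suc b) * suc a ^ s * n ≤⟨ *-monoˡ-≤ n (step-D a b 2≤b) ⟩
        D ^ (2 ^ s ∸ b) * b ^ a * n ≡⟨ *-assoc (D ^ (2 ^ s ∸ b)) (b ^ a) n ⟩
        D ^ (2 ^ s ∸ b) * (b ^ a * n) ≡⟨ cong (D ^ (2 ^ s ∸ b) *_) (sym eq) ⟩
        D ^ (2 ^ s ∸ b) * N ∎

    -- A single T has to serve all N ≤ M, so the individual bounds are combined by a running
    -- maximum. The estimate survives because a maximum equals one of its two arguments. `C` is the
    -- constant of `rough-divisors` for the start b = 2.
    divisors-≲ : ∃ λ C → ∀ M → ∃ λ T → T ^ s ≤ C * M × (∀ N → 1 ≤ N → N ≤ M → (_∣ N) ≲ T)
    divisors-≲ = C , go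
      where
      C = D ^ (2 ^ s ∸ 2)
      go : ∀ M → ∃ λ T → T ^ s ≤ C * M × (∀ N → 1 ≤ N → N ≤ M → (_∣ N) ≲ T)
      go zero = 0 , subst (_≤ C * 0) (sym (0^ s 1≤s)) z≤n , λ { (suc _) _ () }
        where
        0^ : ∀ s → 1 ≤ s → 0 ^ s ≡ 0
        0^ (suc s) _ = refl
      go (suc M) with go M | rough-divisors (suc M) 2 (suc M) ≤-refl (s≤s z≤n) (m≤n+m _ 1) 2-rough
      ... | T , T^s≤ , T-bound | t , t^s≤ , t-bound = T ⊔ t , pow , count
        where
        pow : (T ⊔ t) ^ s ≤ C * suc M
        pow with ⊔-sel T t
        ... | inj₁ eq = subst (λ x → x ^ s ≤ C * suc M) (sym eq) (≤-trans T^s≤ (*-monoʳ-≤ C (n≤1+n M)))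
        ... | inj₂ eq = subst (λ x → x ^ s ≤ C * suc M) (sym eq) t^s≤
        count : ∀ N → 1 ≤ N → N ≤ suc M → (_∣ N) ≲ T ⊔ t
        count N 1≤N N≤1+M with m≤n⇒m<n∨m≡n N≤1+M
        ... | inj₁ (s≤s N≤M) = ≲-mono (λ d → d) (m≤m⊔n T t) (T-bound N 1≤N N≤M)
        ... | inj₂ refl = ≲-mono (λ d → d) (m≤n⊔m T t) t-bound

open DivisorBound

-- Fraction-free elimination with size bounds

module Elimination where
  open import Data.Integer using (+_; ∣_∣; _+_; _*_; _-_; -_)
  open import Data.Integer.Tactic.RingSolver using (solve-∀)
  open import Algebra.Properties.Semiring.Sum ℤₚ.+-*-semiring using (sum; sum-cong-≗)
  open import Data.Fin.Properties using (any?)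

  infix 7 _∙_

  _∙_ : ∀ {n} → (Fin n → ℤ) → (Fin n → ℤ) → ℤ
  x ∙ y = sum λ j → x j * y j

  ∙-zero : ∀ {n} (x y : Fin n → ℤ) → (∀ j → y j ≡ + 0) → x ∙ y ≡ + 0
  ∙-zero {zero} x y eq = refl
  ∙-zero {suc n} x y eq = cong₂ _+_ (trans (cong (x zero *_) (eq zero)) (ℤₚ.*-zeroʳ (x zero)))
    (∙-zero (λ j → x (suc j)) (λ j → y (suc j)) (λ j → eq (suc j)))

  ∙-linˡ : ∀ {n} a b (x y w : Fin n → ℤ) → (λ j → a * x j - b * y j) ∙ w ≡ a * (x ∙ w) - b * (y ∙ w)
  ∙-linˡ {zero} a b x y w = base a b
    where
    base : ∀ a b → + 0 ≡ a * + 0 - b * + 0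
    base = solve-∀
  ∙-linˡ {suc n} a b x y w =
    trans (cong (λ s → (a * x zero - b * y zero) * w zero + s) (∙-linˡ a b (λ j → x (suc j)) (λ j → y (suc j)) (λ j → w (suc j))))
          (step a b (x zero) (y zero) (w zero) _ _)
    where
    step : ∀ a b x y w s t → (a * x - b * y) * w + (a * s - b * t) ≡ a * (x * w + s) - b * (y * w + t)
    step = solve-∀

  ∙-linʳ : ∀ {n} a b (w x y : Fin n → ℤ) → w ∙ (λ j → x j * a + y j * b) ≡ (w ∙ x) * a + (w ∙ y) * b
  ∙-linʳ {zero} a b w x y = base a b
    where
    base : ∀ a b → + 0 ≡ + 0 * a + + 0 * b
    base = solve-∀
  ∙-linʳ {suc n} a b w x y =
    trans (cong (λ s → w zero * (x zero * a + y zero * b) + s) (∙-linʳ a b (λ j → w (suc j)) (λ j → x (suc j)) (λ j → y (suc j))))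
          (step a b (x zero) (y zero) (w zero) _ _)
    where
    step : ∀ a b x y w s t → w * (x * a + y * b) + (s * a + t * b) ≡ (w * x + s) * a + (w * y + t) * b
    step = solve-∀

  ∙-scaleʳ : ∀ {n} a (x w : Fin n → ℤ) → x ∙ (λ j → a * w j) ≡ a * (x ∙ w)
  ∙-scaleʳ {zero} a x w = sym (ℤₚ.*-zeroʳ a)
  ∙-scaleʳ {suc n} a x w = trans (cong (λ s → x zero * (a * w zero) + s) (∙-scaleʳ a (λ j → x (suc j)) (λ j → w (suc j))))
      (step a (x zero) (w zero) _)
    where
    step : ∀ a x w s → x * (a * w) + a * s ≡ a * (x * w + s)
    step = solve-∀

  ∣*∣≤ : ∀ x y {X Y} → ∣ x ∣ ≤ X → ∣ y ∣ ≤ Y → ∣ x * y ∣ ≤ X ℕ.* Y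
  ∣*∣≤ x y x≤ y≤ = subst (_≤ _) (sym (ℤₚ.abs-* x y)) (ℕₚ.*-mono-≤ x≤ y≤)

  ∣+∣≤ : ∀ x y {X Y} → ∣ x ∣ ≤ X → ∣ y ∣ ≤ Y → ∣ x + y ∣ ≤ X ℕ.+ Y
  ∣+∣≤ x y x≤ y≤ = ℕₚ.≤-trans (ℤₚ.∣i+j∣≤∣i∣+∣j∣ x y) (ℕₚ.+-mono-≤ x≤ y≤)

  ∣-∣≤ : ∀ x y {X Y} → ∣ x ∣ ≤ X → ∣ y ∣ ≤ Y → ∣ x - y ∣ ≤ X ℕ.+ Y
  ∣-∣≤ x y x≤ y≤ = ℕₚ.≤-trans (ℤₚ.∣i-j∣≤∣i∣+∣j∣ x y) (ℕₚ.+-mono-≤ x≤ y≤)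

  ∣∙∣≤ : ∀ {n} (x y : Fin n → ℤ) {X Y} → (∀ j → ∣ x j ∣ ≤ X) → (∀ j → ∣ y j ∣ ≤ Y) → ∣ x ∙ y ∣ ≤ n ℕ.* (X ℕ.* Y)
  ∣∙∣≤ {zero} x y x≤ y≤ = z≤n
  ∣∙∣≤ {suc n} x y x≤ y≤ = ∣+∣≤ (x zero * y zero) _ (∣*∣≤ (x zero) (y zero) (x≤ zero) (y≤ zero))
    (∣∙∣≤ (λ j → x (suc j)) (λ j → y (suc j)) (λ j → x≤ (suc j)) (λ j → y≤ (suc j)))

  ≢0-* : ∀ {x y} → x ≢ + 0 → y ≢ + 0 → x * y ≢ + 0
  ≢0-* {x} x≢0 y≢0 eq with ℤₚ.i*j≡0⇒i≡0∨j≡0 x eq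
  ... | inj₁ e = x≢0 e
  ... | inj₂ e = y≢0 e

  HasKernel : ∀ {r c} → (Fin r → Fin c → ℤ) → Set
  HasKernel {c = c} D = Σ (Fin c → ℤ) λ v → (∃ λ j → v j ≢ + 0) × (∀ i → D i ∙ v ≡ + 0)

  -- One elimination step turns the entries into 2 × 2 minors of size at most 2H². The outer factor
  -- pays for the back substitution, a sum of c + 1 products of an entry and an already bounded
  -- coefficient.
  elimBound : ℕ → ℕ → ℕ
  elimBound zero H = 1
  elimBound (suc c) H = suc c ℕ.* (H ℕ.* elimBound c (2 ℕ.* (H ℕ.* H)))

  -- For an invertible square D the vectors f/δ and g/δ are -D⁻¹V and -D⁻¹W, over a common
  -- denominator.
  record Solved {r c} (B : ℕ) (D : Fin r → Fin c → ℤ) (V W : Fin r → ℤ) : Set where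
    field
      δ : ℤ
      δ≢0 : δ ≢ + 0
      f g : Fin c → ℤ
      ∣δ∣≤ : ∣ δ ∣ ≤ B
      ∣f∣≤ : ∀ j → ∣ f j ∣ ≤ B
      ∣g∣≤ : ∀ j → ∣ g j ∣ ≤ B
      solution : ∀ a b q → (∀ i → V i * a + W i * b + D i ∙ q ≡ + 0) → ∀ j → δ * q j ≡ f j * a + g j * b

  -- Fraction-free Gaussian elimination on the columns; the pivot row is kept, since it merely becomes zero.
  eliminate : ∀ {r} c H (D : Fin r → Fin c → ℤ) (V W : Fin r → ℤ) →
    (∀ i j → ∣ D i j ∣ ≤ H) → (∀ i → ∣ V i ∣ ≤ H) → (∀ i → ∣ W i ∣ ≤ H) →
    HasKernel D ⊎ Solved (elimBound c H) D V W
  eliminate zero H D V W D≤ V≤ W≤ = inj₂ record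
    { δ = + 1 ; δ≢0 = λ () ; f = λ () ; g = λ () ; ∣δ∣≤ = ℕₚ.≤-refl
    ; ∣f∣≤ = λ () ; ∣g∣≤ = λ () ; solution = λ _ _ _ _ () }
  eliminate {r} (suc c) H D V W D≤ V≤ W≤ with any? (λ i → ¬? (D i zero ℤₚ.≟ + 0))
  ... | no none = inj₁ (e₀ , (zero , λ ()) , λ i → cong₂ _+_
          (trans (ℤₚ.*-identityʳ (D i zero)) (decidable-stable (D i zero ℤₚ.≟ + 0) (λ ne → none (i , ne))))
          (∙-zero (λ j → D i (suc j)) (λ j → e₀ (suc j)) (λ _ → refl)))
    where
    e₀ : Fin (suc c) → ℤ
    e₀ zero = + 1
    e₀ (suc _) = + 0
  ... | yes (i₀ , a≢0) = result (eliminate c (2 ℕ.* (H ℕ.* H)) D′ V′ W′ D′≤ V′≤ W′≤)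
    where
    a = D i₀ zero
    D′ : Fin r → Fin c → ℤ
    D′ i j = a * D i (suc j) - D i zero * D i₀ (suc j)
    V′ W′ : Fin r → ℤ
    V′ i = a * V i - D i zero * V i₀
    W′ i = a * W i - D i zero * W i₀
    u : Fin c → ℤ
    u j = D i₀ (suc j)
    B = elimBound c (2 ℕ.* (H ℕ.* H))

    2HH : H ℕ.* H ℕ.+ H ℕ.* H ≡ 2 ℕ.* (H ℕ.* H)
    2HH = cong (H ℕ.* H ℕ.+_) (sym (ℕₚ.+-identityʳ _))
    cross : ∀ x y z w → ∣ x ∣ ≤ H → ∣ y ∣ ≤ H → ∣ z ∣ ≤ H → ∣ w ∣ ≤ H → ∣ x * y - z * w ∣ ≤ 2 ℕ.* (H ℕ.* H)
    cross x y z w x≤ y≤ z≤ w≤ = subst (∣ x * y - z * w ∣ ≤_) 2HH (∣-∣≤ (x * y) (z * w) (∣*∣≤ x y x≤ y≤) (∣*∣≤ z w z≤ w≤))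
    D′≤ : ∀ i j → ∣ D′ i j ∣ ≤ 2 ℕ.* (H ℕ.* H)
    D′≤ i j = cross a (D i (suc j)) (D i zero) (u j) (D≤ _ _) (D≤ _ _) (D≤ _ _) (D≤ _ _)
    V′≤ : ∀ i → ∣ V′ i ∣ ≤ 2 ℕ.* (H ℕ.* H)
    V′≤ i = cross a (V i) (D i zero) (V i₀) (D≤ _ _) (V≤ _) (D≤ _ _) (V≤ _)
    W′≤ : ∀ i → ∣ W′ i ∣ ≤ 2 ℕ.* (H ℕ.* H)
    W′≤ i = cross a (W i) (D i zero) (W i₀) (D≤ _ _) (W≤ _) (D≤ _ _) (W≤ _)

    HB≤ : H ℕ.* B ≤ elimBound (suc c) H
    HB≤ = ℕₚ.m≤m+n (H ℕ.* B) _

    result : HasKernel D′ ⊎ Solved B D′ V′ W′ → HasKernel D ⊎ Solved (elimBound (suc c) H) D V W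
    result (inj₁ (w , (j , wj≢0) , D′w≡0)) = inj₁ (v , (suc j , ≢0-* a≢0 wj≢0) , row)
      where
      -- Scaling `w` by the pivot lets the pivot row be solved for the first coordinate without
      -- division.
      v : Fin (suc c) → ℤ
      v zero = - (u ∙ w)
      v (suc j) = a * w j
      lift : ∀ d x y a → d * - x + a * y ≡ a * y - d * x
      lift = solve-∀
      row : ∀ i → D i ∙ v ≡ + 0
      row i = trans (cong (λ s → D i zero * - (u ∙ w) + s) (∙-scaleʳ a (λ j → D i (suc j)) w))
        (trans (lift (D i zero) (u ∙ w) ((λ j → D i (suc j)) ∙ w) a)
        (trans (sym (∙-linˡ a (D i zero) (λ j → D i (suc j)) u w)) (D′w≡0 i)))
    result (inj₂ S) = inj₂ record
      { δ = a * δ ; δ≢0 = ≢0-* a≢0 δ≢0 ; f = coeff V f ; g = coeff W g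
      ; ∣δ∣≤ = ℕₚ.≤-trans (∣*∣≤ a δ (D≤ _ _) ∣δ∣≤) HB≤
      ; ∣f∣≤ = coeff≤ V f V≤ ∣f∣≤ ; ∣g∣≤ = coeff≤ W g W≤ ∣g∣≤ ; solution = sol }
      where
      open Solved S
      -- Back substitution: the pivot row times δ expresses aδq₀ through δ times the remaining
      -- coordinates, which are already known in terms of the two parameters.
      coeff : (Fin r → ℤ) → (Fin c → ℤ) → Fin (suc c) → ℤ
      coeff X h zero = - (X i₀ * δ + u ∙ h)
      coeff X h (suc j) = a * h j
      coeff≤ : ∀ X h → (∀ i → ∣ X i ∣ ≤ H) → (∀ j → ∣ h j ∣ ≤ B) → ∀ j → ∣ coeff X h j ∣ ≤ elimBound (suc c) H
      coeff≤ X h X≤ h≤ zero = subst (_≤ _) (sym (ℤₚ.∣-i∣≡∣i∣ (X i₀ * δ + u ∙ h)))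
        (∣+∣≤ (X i₀ * δ) (u ∙ h) (∣*∣≤ (X i₀) δ (X≤ _) ∣δ∣≤) (∣∙∣≤ u h (λ _ → D≤ _ _) h≤))
      coeff≤ X h X≤ h≤ (suc j) = ℕₚ.≤-trans (∣*∣≤ a (h j) (D≤ _ _) (h≤ j)) HB≤

      sol : ∀ x y q → (∀ i → V i * x + W i * y + D i ∙ q ≡ + 0) → ∀ j → a * δ * q j ≡ coeff V f j * x + coeff W g j * y
      sol x y q eqs = λ where
          zero → trans (expand a δ (q zero) (V i₀) (W i₀) x y (u ∙ q′))
                   (trans (cong₂ (λ s t → δ * s - (V i₀ * δ * x + W i₀ * δ * y + t)) (eqs i₀) uq′)
                          (collect δ (V i₀) (W i₀) x y (u ∙ f) (u ∙ g)))
          (suc j) → trans (ℤₚ.*-assoc a δ (q (suc j))) (trans (cong (a *_) (sub j)) (scale a (f j) (g j) x y))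
        where
        q′ : Fin c → ℤ
        q′ j = q (suc j)
        combine : ∀ a d v w v₀ w₀ x y q s s₀ →
          (a * v - d * v₀) * x + (a * w - d * w₀) * y + (a * s - d * s₀) ≡
          a * (v * x + w * y + (d * q + s)) - d * (v₀ * x + w₀ * y + (a * q + s₀))
        combine = solve-∀
        eqs′ : ∀ i → V′ i * x + W′ i * y + D′ i ∙ q′ ≡ + 0
        eqs′ i = trans (cong (λ s → V′ i * x + W′ i * y + s) (∙-linˡ a (D i zero) (λ j → D i (suc j)) u q′))
          (trans (combine a (D i zero) (V i) (W i) (V i₀) (W i₀) x y (q zero) ((λ j → D i (suc j)) ∙ q′) (u ∙ q′))
          (trans (cong₂ (λ s t → a * s - D i zero * t) (eqs i) (eqs i₀)) (zeros a (D i zero))))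
          where
          zeros : ∀ a b → a * + 0 - b * + 0 ≡ + 0
          zeros = solve-∀
        sub : ∀ j → δ * q′ j ≡ f j * x + g j * y
        sub = solution x y q′ eqs′
        uq′ : δ * (u ∙ q′) ≡ (u ∙ f) * x + (u ∙ g) * y
        uq′ = trans (sym (∙-scaleʳ δ u q′)) (trans (sum-cong-≗ λ j → cong (u j *_) (sub j)) (∙-linʳ x y u f g))
        expand : ∀ a δ q v w x y s → a * δ * q ≡ δ * (v * x + w * y + (a * q + s)) - (v * δ * x + w * δ * y + δ * s)
        expand = solve-∀
        collect : ∀ δ v w x y s t → δ * + 0 - (v * δ * x + w * δ * y + (s * x + t * y)) ≡ - (v * δ + s) * x + - (w * δ + t) * y
        collect = solve-∀
        scale : ∀ a f g x y → a * (f * x + g * y) ≡ a * f * x + a * g * y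
        scale = solve-∀

open Elimination

-- Counting the 2 × 2 blocks that satisfy the product equation

module SingularBlocks where
  open import Data.Integer using (+_; -[1+_]; ∣_∣; _+_; _*_)
  open import Data.Nat.Divisibility using (_∣_; divides)
  import Algebra.Properties.AbelianGroup ℤₚ.+-0-abelianGroup as ℤGroup

  *-cancelˡ-≢0 : ∀ i {j k} → i ≢ + 0 → i * j ≡ i * k → j ≡ k
  *-cancelˡ-≢0 i i≢0 = ℤₚ.*-cancelˡ-≡ i _ _ {{ℤ.≢-nonZero i≢0}}

  affine-injective : ∀ {δ} c {x y} → δ ≢ + 0 → δ * x + c ≡ δ * y + c → x ≡ y
  affine-injective {δ} c δ≢0 eq = *-cancelˡ-≢0 δ δ≢0 (ℤGroup.∙-cancelʳ c _ _ eq)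

  -- Divisors are counted among natural numbers, while the factors of the product equation carry a
  -- sign; hence the doubling.
  signed-≲ : ∀ {P : ℕ → Set} {T} → P ≲ T → (λ X → P ∣ X ∣) ≲ T ℕ.+ T
  signed-≲ {P} P≲T = ≲-union (λ {X} → split {X})
      (≲-inj ℕₚ._≟_ ∣_∣ proj₁ (λ { (_ , _ , refl) (_ , _ , refl) refl → refl }) P≲T)
      (≲-inj ℕₚ._≟_ ∣_∣ proj₁ (λ { (_ , _ , refl) (_ , _ , refl) refl → refl }) P≲T)
    where
    split : ∀ {X} → P ∣ X ∣ → (P ∣ X ∣ × ∃ λ n → X ≡ + n) ⊎ (P ∣ X ∣ × ∃ λ n → X ≡ -[1+ n ])
    split {+ n} p = inj₁ (p , n , refl)
    split { -[1+ n ]} p = inj₂ (p , n , refl)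

  module _ (δ : ℤ) (δ≢0 : δ ≢ + 0) where

    factorisations-≲ : ∀ c d N {T} → N ≢ + 0 → (_∣ ∣ N ∣) ≲ T →
      (λ (xw : ℤ × ℤ) → (δ * proj₁ xw + c) * (δ * proj₂ xw + d) ≡ N) ≲ T ℕ.+ T
    factorisations-≲ c d N N≢0 N≲T = ≲-inj ℤₚ._≟_ (λ { (x , w) → δ * x + c }) {Q = λ X → ∣ X ∣ ∣ ∣ N ∣}
        divisor inj (signed-≲ N≲T)
      where
      divisor : ∀ {xw : ℤ × ℤ} → (δ * proj₁ xw + c) * (δ * proj₂ xw + d) ≡ N → ∣ δ * proj₁ xw + c ∣ ∣ ∣ N ∣
      divisor {x , w} eq = divides ∣ δ * w + d ∣ (trans (cong ∣_∣ (trans (sym eq) (ℤₚ.*-comm (δ * x + c) (δ * w + d))))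
        (ℤₚ.abs-* (δ * w + d) (δ * x + c)))
      inj : ∀ {xw yv : ℤ × ℤ} → (δ * proj₁ xw + c) * (δ * proj₂ xw + d) ≡ N →
        (δ * proj₁ yv + c) * (δ * proj₂ yv + d) ≡ N → δ * proj₁ xw + c ≡ δ * proj₁ yv + c → xw ≡ yv
      inj {x , w} {y , v} eq eq′ e with affine-injective c δ≢0 e
      ... | refl = cong (x ,_) (affine-injective d δ≢0 (*-cancelˡ-≢0 (δ * x + c) X≢0 (trans eq (sym eq′))))
        where
        X≢0 : δ * x + c ≢ + 0
        X≢0 X≡0 = N≢0 (trans (sym eq) (trans (cong (_* (δ * w + d)) X≡0) (ℤₚ.*-zeroˡ (δ * w + d))))

    root-≲ : ∀ c → (λ x → δ * x + c ≡ + 0) ≲ 1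
    root-≲ c = ≲-1 λ e e′ → affine-injective c δ≢0 (trans e (sym e′))

    module _ (k : ℕ) where
      private K = 1 ℕ.+ 2 ℕ.* k

      Box² : ℤ × ℤ → Set
      Box² (x , y) = InI k x × InI k y

      zero-products-≲ : ∀ c d → (λ (xw : ℤ × ℤ) → Box² xw × (δ * proj₁ xw + c) * (δ * proj₂ xw + d) ≡ + 0) ≲ K ℕ.+ K
      zero-products-≲ c d = ≲-union split
        (≲-mono (λ p → p) (ℕₚ.≤-reflexive (ℕₚ.*-identityˡ K)) (≲-× ℤₚ._≟_ (root-≲ c) (InI-≲ k)))
        (≲-mono (λ p → p) (ℕₚ.≤-reflexive (ℕₚ.*-identityʳ K)) (≲-× ℤₚ._≟_ (InI-≲ k) (root-≲ d)))
        where
        split : ∀ {xw : ℤ × ℤ} → Box² xw × (δ * proj₁ xw + c) * (δ * proj₂ xw + d) ≡ + 0 →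
          (δ * proj₁ xw + c ≡ + 0 × InI k (proj₂ xw)) ⊎ (InI k (proj₁ xw) × δ * proj₂ xw + d ≡ + 0)
        split {x , w} ((bx , bw) , eq) with ℤₚ.i*j≡0⇒i≡0∨j≡0 (δ * x + c) eq
        ... | inj₁ e = inj₁ (e , bw)
        ... | inj₂ e = inj₂ (bx , e)

      -- The antidiagonal pair comes first because it fixes the right-hand side over which the
      -- diagonal pairs are counted.
      SingularBlock : (c₁ c₂ c₃ c₄ : ℤ) → (ℤ × ℤ) × (ℤ × ℤ) → Set
      SingularBlock c₁ c₂ c₃ c₄ ((y , z) , (x , w)) = Box² (y , z) × Box² (x , w) ×
        (δ * x + c₁) * (δ * w + c₄) ≡ (δ * y + c₂) * (δ * z + c₃)

      -- The first summand counts the blocks with nonzero right-hand side: K² antidiagonals with at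
      -- most 2T diagonals each. If the right-hand side vanishes, so does the left, and each of the
      -- two pairs lies on two lines with at most K points each. The bound R² on the right-hand side
      -- makes one T valid for all of them.
      singular-blocks-≲ : ∀ c₁ c₂ c₃ c₄ {R T} →
        (∀ {y} → InI k y → ∣ δ * y + c₂ ∣ ≤ R) → (∀ {z} → InI k z → ∣ δ * z + c₃ ∣ ≤ R) →
        (∀ N → 1 ≤ N → N ≤ R ℕ.* R → (_∣ N) ≲ T) →
        SingularBlock c₁ c₂ c₃ c₄ ≲ (K ℕ.* K) ℕ.* (T ℕ.+ T) ℕ.+ (K ℕ.+ K) ℕ.* (K ℕ.+ K)
      singular-blocks-≲ c₁ c₂ c₃ c₄ {R} {T} Y≤ Z≤ div = ≲-union split
          (≲-Σ dec {P = λ yz → Box² yz × N yz ≢ + 0} {Q = λ yz xw → (δ * proj₁ xw + c₁) * (δ * proj₂ xw + c₄) ≡ N yz}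
            (≲-mono proj₁ ℕₚ.≤-refl (≲-× ℤₚ._≟_ (InI-≲ k) (InI-≲ k)))
            (λ { (y , z) ((by , bz) , N≢0) → factorisations-≲ c₁ c₄ (N (y , z)) N≢0
               (div _ (abs-pos N≢0) (∣*∣≤ (δ * y + c₂) (δ * z + c₃) (Y≤ by) (Z≤ bz))) }))
          (≲-× dec (zero-products-≲ c₂ c₃) (zero-products-≲ c₁ c₄))
        where
        dec = ×-≡-dec ℤₚ._≟_ ℤₚ._≟_
        N : ℤ × ℤ → ℤ
        N (y , z) = (δ * y + c₂) * (δ * z + c₃)
        abs-pos : ∀ {i} → i ≢ + 0 → 1 ≤ ∣ i ∣
        abs-pos {+ zero} ne = contradiction refl ne
        abs-pos {+ suc n} ne = s≤s z≤n
        abs-pos { -[1+ n ]} ne = s≤s z≤n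
        split : ∀ {b} → SingularBlock c₁ c₂ c₃ c₄ b →
          ((Box² (proj₁ b) × N (proj₁ b) ≢ + 0) × (δ * proj₁ (proj₂ b) + c₁) * (δ * proj₂ (proj₂ b) + c₄) ≡ N (proj₁ b)) ⊎
          ((Box² (proj₁ b) × N (proj₁ b) ≡ + 0) × (Box² (proj₂ b) × (δ * proj₁ (proj₂ b) + c₁) * (δ * proj₂ (proj₂ b) + c₄) ≡ + 0))
        split {yz , xw} (byz , bxw , eq) with N yz ℤₚ.≟ + 0
        ... | yes N≡0 = inj₂ ((byz , N≡0) , (bxw , trans eq N≡0))
        ... | no N≢0 = inj₁ ((byz , N≢0) , eq)

open SingularBlocks

-- Matrices with a prescribed integer eigenvalue

module FixedEigenvalue where
  open import Data.Integer using (+_; ∣_∣; _+_; _*_; _-_; -_)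
  open import Data.Nat.Divisibility using (_∣_)
  open import Data.Integer.Tactic.RingSolver using (solve-∀)
  open import Algebra.Properties.Semiring.Sum ℤₚ.+-*-semiring using (sum-cong-≗)
  open import Data.Vec.Relation.Unary.All using (All; []; _∷_)

  -- Recursion on both indices makes the entries of `shift` reduce at constructors, so that its
  -- blocks agree by computation with those of `Columns`.
  kronecker : ∀ {n} → Fin n → Fin n → ℤ
  kronecker zero zero = + 1
  kronecker zero (suc _) = + 0
  kronecker (suc _) zero = + 0
  kronecker (suc i) (suc j) = kronecker i j

  ∣kronecker∣≤1 : ∀ {n} (i j : Fin n) → ∣ kronecker i j ∣ ≤ 1
  ∣kronecker∣≤1 zero zero = s≤s z≤n
  ∣kronecker∣≤1 zero (suc _) = z≤n
  ∣kronecker∣≤1 (suc _) zero = z≤n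
  ∣kronecker∣≤1 (suc i) (suc j) = ∣kronecker∣≤1 i j

  kronecker-∙ : ∀ {n} (i : Fin n) v → kronecker i ∙ v ≡ v i
  kronecker-∙ zero v = trans (cong₂ _+_ (ℤₚ.*-identityˡ (v zero)) (zeros (λ j → v (suc j)))) (ℤₚ.+-identityʳ (v zero))
    where
    zeros : ∀ {n} (v : Fin n → ℤ) → (λ _ → + 0) ∙ v ≡ + 0
    zeros {zero} v = refl
    zeros {suc n} v = cong₂ _+_ (ℤₚ.*-zeroˡ (v zero)) (zeros (λ j → v (suc j)))
  kronecker-∙ (suc i) v = trans (cong₂ _+_ (ℤₚ.*-zeroˡ (v zero)) (kronecker-∙ i (λ j → v (suc j)))) (ℤₚ.+-identityˡ (v (suc i)))

  shift : ∀ {n} → ℤ → Mat ℤ n → Fin n → Fin n → ℤ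
  shift μ A i j = lookup (lookup A i) j - μ * kronecker i j

  IsEigenvalueℤ : ∀ {n} → ℤ → Mat ℤ n → Set
  IsEigenvalueℤ μ A = HasKernel (shift μ A)

  Eigen : ∀ n k → ℤ → Mat ℤ n → Set
  Eigen n k μ A = InM n k A × IsEigenvalueℤ μ A

  det2-zero : ∀ P Q R S a b → P * a + Q * b ≡ + 0 → R * a + S * b ≡ + 0 → a ≢ + 0 ⊎ b ≢ + 0 → P * S ≡ Q * R
  det2-zero P Q R S a b e₁ e₂ ne = ℤₚ.i-j≡0⇒i≡j (P * S) (Q * R) (factor ne)
    where
    zeros : ∀ x y → x * + 0 - y * + 0 ≡ + 0
    zeros = solve-∀
    cramer₁ : ∀ P Q R S a b → (P * S - Q * R) * a ≡ S * (P * a + Q * b) - Q * (R * a + S * b)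
    cramer₁ = solve-∀
    cramer₂ : ∀ P Q R S a b → (P * S - Q * R) * b ≡ P * (R * a + S * b) - R * (P * a + Q * b)
    cramer₂ = solve-∀
    cancel : ∀ {x y} → y ≢ + 0 → x * y ≡ + 0 → x ≡ + 0
    cancel {x} y≢0 eq with ℤₚ.i*j≡0⇒i≡0∨j≡0 x eq
    ... | inj₁ e = e
    ... | inj₂ e = contradiction e y≢0
    factor : a ≢ + 0 ⊎ b ≢ + 0 → P * S - Q * R ≡ + 0
    factor (inj₁ a≢0) = cancel a≢0 (trans (cramer₁ P Q R S a b)
      (trans (cong₂ (λ s t → S * s - Q * t) e₁ e₂) (zeros S Q)))
    factor (inj₂ b≢0) = cancel b≢0 (trans (cramer₂ P Q R S a b)
      (trans (cong₂ (λ s t → P * s - R * t) e₂ e₁) (zeros P R)))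

  _≟ᵛ_ : ∀ {n} → DecidableEquality (Vec ℤ n)
  _≟ᵛ_ = Vecₚ.≡-dec ℤₚ._≟_

  _≟ᵐ_ : ∀ {n m} → DecidableEquality (Vec (Vec ℤ n) m)
  _≟ᵐ_ = Vecₚ.≡-dec _≟ᵛ_

  module _ {m : ℕ} where

    -- All of the matrix except its upper left 2 × 2 block: first the two rows of U, then the rows
    -- of [V D].
    Context : Set
    Context = (Vec ℤ m × Vec ℤ m) × Vec (Vec ℤ (2 ℕ.+ m)) m

    context : Mat ℤ (2 ℕ.+ m) → Context
    context ((x ∷ y ∷ u) ∷ (z ∷ w ∷ v) ∷ rows) = (u , v) , rows

    block : Mat ℤ (2 ℕ.+ m) → (ℤ × ℤ) × (ℤ × ℤ)
    block ((x ∷ y ∷ u) ∷ (z ∷ w ∷ v) ∷ rows) = (y , z) , (x , w)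

    context-block-injective : ∀ {A B} → context A ≡ context B → block A ≡ block B → A ≡ B
    context-block-injective {(x ∷ y ∷ u) ∷ (z ∷ w ∷ v) ∷ rows} {(x′ ∷ y′ ∷ u′) ∷ (z′ ∷ w′ ∷ v′) ∷ rows′} refl refl = refl

    _≟ᶜ_ : DecidableEquality Context
    _≟ᶜ_ = ×-≡-dec (×-≡-dec _≟ᵛ_ _≟ᵛ_) _≟ᵐ_

    InContext : ℕ → Context → Set
    InContext k ((u , v) , rows) = (All (InI k) u × All (InI k) v) × All (All (InI k)) rows

    InContext-≲ : ∀ k → let K = 1 ℕ.+ 2 ℕ.* k in InContext k ≲ (K ℕ.^ m ℕ.* K ℕ.^ m) ℕ.* (K ℕ.^ (2 ℕ.+ m)) ℕ.^ m
    InContext-≲ k = ≲-× (×-≡-dec _≟ᵛ_ _≟ᵛ_) (≲-× _≟ᵛ_ (≲-Vec ℤₚ._≟_ (InI-≲ k) m) (≲-Vec ℤₚ._≟_ (InI-≲ k) m))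
      (≲-Vec _≟ᵛ_ (≲-Vec ℤₚ._≟_ (InI-≲ k) (2 ℕ.+ m)) m)

    private
      ss : Fin m → Fin (2 ℕ.+ m)
      ss j = suc (suc j)

    -- The terms μ * + 0 keep these entries definitionally equal to those of shift μ A.
    module Columns (μ : ℤ) (c : Context) where
      D : Fin m → Fin m → ℤ
      D i j = lookup (lookup (proj₂ c) i) (ss j) - μ * kronecker i j
      V W : Fin m → ℤ
      V i = lookup (lookup (proj₂ c) i) zero - μ * + 0
      W i = lookup (lookup (proj₂ c) i) (suc zero) - μ * + 0
      U₁ U₂ : Fin m → ℤ
      U₁ j = lookup (proj₁ (proj₁ c)) j - μ * + 0
      U₂ j = lookup (proj₂ (proj₁ c)) j - μ * + 0

    drop₂ : Vec ℤ (2 ℕ.+ m) → Vec ℤ m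
    drop₂ (_ ∷ _ ∷ r) = r

    take₂ : Vec ℤ (2 ℕ.+ m) → Vec ℤ 2
    take₂ (x ∷ y ∷ _) = x ∷ y ∷ []

    corner : Mat ℤ (2 ℕ.+ m) → Mat ℤ m
    corner (_ ∷ _ ∷ rows) = Vec.map drop₂ rows

    corner-eigenvalue : ∀ μ A → HasKernel (Columns.D μ (context A)) → IsEigenvalueℤ μ (corner A)
    corner-eigenvalue μ ((x ∷ y ∷ u) ∷ (z ∷ w ∷ v) ∷ rows) (q , q≢0 , eqs) = q , q≢0 , λ i →
        trans (sum-cong-≗ λ j → cong (λ t → (t - μ * kronecker i j) * q j) (entry i j)) (eqs i)
      where
      lookup-drop₂ : ∀ (r : Vec ℤ (2 ℕ.+ m)) j → lookup (drop₂ r) j ≡ lookup r (ss j)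
      lookup-drop₂ (_ ∷ _ ∷ r) j = refl
      entry : ∀ i j → lookup (lookup (Vec.map drop₂ rows) i) j ≡ lookup (lookup rows i) (ss j)
      entry i j = trans (cong (λ r → lookup r j) (Vecₚ.lookup-map i drop₂ rows)) (lookup-drop₂ (lookup rows i) j)

    -- The condition concerns the corner alone. The factor counts the free entries: two full rows,
    -- and the first two entries of each of the m rows below.
    corner-≲ : ∀ {k N} {P : Mat ℤ m → Set} → let K = 1 ℕ.+ 2 ℕ.* k in (λ A → InM m k A × P A) ≲ N →
      (λ A → InM (2 ℕ.+ m) k A × P (corner A)) ≲ N ℕ.* ((K ℕ.^ (2 ℕ.+ m)) ℕ.^ 2 ℕ.* (K ℕ.^ 2) ℕ.^ m)
    corner-≲ {k} {N} {P} N-bound = ≲-inj (×-≡-dec _≟ᵐ_ (×-≡-dec _≟ᵐ_ _≟ᵐ_)) parts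
        (λ { {r ∷ s ∷ rows} ((br ∷ bs ∷ brows) , p) → (inDrop brows , p) , (br ∷ bs ∷ []) , inTake brows })
        (λ _ _ → inj _ _)
        (≲-× _≟ᵐ_ N-bound (≲-× _≟ᵐ_ (≲-Vec _≟ᵛ_ (≲-Vec ℤₚ._≟_ (InI-≲ k) (2 ℕ.+ m)) 2)
                                      (≲-Vec _≟ᵛ_ (≲-Vec ℤₚ._≟_ (InI-≲ k) 2) m)))
      where
      parts : Mat ℤ (2 ℕ.+ m) → Mat ℤ m × (Vec (Vec ℤ (2 ℕ.+ m)) 2 × Vec (Vec ℤ 2) m)
      parts A@(r ∷ s ∷ rows) = corner A , (r ∷ s ∷ []) , Vec.map take₂ rows
      inDrop : ∀ {l} {rows : Vec _ l} → All (All (InI k)) rows → All (All (InI k)) (Vec.map drop₂ rows)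
      inDrop [] = []
      inDrop {rows = (_ ∷ _ ∷ _) ∷ _} ((_ ∷ _ ∷ b) ∷ bs) = b ∷ inDrop bs
      inTake : ∀ {l} {rows : Vec _ l} → All (All (InI k)) rows → All (All (InI k)) (Vec.map take₂ rows)
      inTake [] = []
      inTake {rows = (_ ∷ _ ∷ _) ∷ _} ((b ∷ c ∷ _) ∷ bs) = (b ∷ c ∷ []) ∷ inTake bs
      rows-inj : ∀ {l} (rows rows′ : Vec _ l) → Vec.map drop₂ rows ≡ Vec.map drop₂ rows′ →
        Vec.map take₂ rows ≡ Vec.map take₂ rows′ → rows ≡ rows′
      rows-inj [] [] _ _ = refl
      rows-inj ((x ∷ y ∷ r) ∷ rows) ((x′ ∷ y′ ∷ r′) ∷ rows′) e e′
        with Vecₚ.∷-injective e | Vecₚ.∷-injective e′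
      ... | refl , es | refl , es′ = cong (_ ∷_) (rows-inj rows rows′ es es′)
      inj : ∀ A B → parts A ≡ parts B → A ≡ B
      inj (r ∷ s ∷ rows) (r′ ∷ s′ ∷ rows′) eq with cong proj₁ eq | cong (λ t → proj₁ (proj₂ t)) eq | cong (λ t → proj₂ (proj₂ t)) eq
      ... | e | refl | e′ = cong (λ t → r ∷ s ∷ t) (rows-inj rows rows′ e e′)

    module _ (k H : ℕ) (μ : ℤ) (k+∣μ∣≤H : k ℕ.+ ∣ μ ∣ ≤ H) where

      entry≤ : ∀ {x} κ → ∣ κ ∣ ≤ 1 → InI k x → ∣ x - μ * κ ∣ ≤ H
      entry≤ {x} κ κ≤1 x∈ = ℕₚ.≤-trans (∣-∣≤ x (μ * κ) (InI⇒∣∣≤ x∈) (∣*∣≤ μ κ (ℕₚ.≤-refl {∣ μ ∣}) κ≤1))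
        (subst (λ t → k ℕ.+ t ≤ H) (sym (ℕₚ.*-identityʳ ∣ μ ∣)) k+∣μ∣≤H)

      private
        K = 1 ℕ.+ 2 ℕ.* k
        B = elimBound m H
        R = suc m ℕ.* (H ℕ.* B)

      SolvedContext : Context → Set
      SolvedContext c = Solved B D V W
        where open Columns μ c

      solve-context : ∀ c → InContext k c → HasKernel (Columns.D μ c) ⊎ SolvedContext c
      solve-context c@((u , v) , rows) (_ , brows) = eliminate m H D V W
          (λ i j → entry≤ (kronecker i j) (∣kronecker∣≤1 i j) (at i (ss j)))
          (λ i → entry≤ (+ 0) z≤n (at i zero)) (λ i → entry≤ (+ 0) z≤n (at i (suc zero)))
        where
        open Columns μ c
        at : ∀ i j → InI k (lookup (lookup rows i) j)
        at i j = VAllₚ.lookup⁺ (VAllₚ.lookup⁺ brows i) j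

      module _ (c : Context) (S : SolvedContext c) where
        open Columns μ c
        open Solved S

        -- The matrix [δx + c₁, δy + c₂; δz + c₃, δw + c₄] is δ times the Schur complement of D in A
        -- - μ when D is invertible. The constants do not involve the block itself.
        c₁ c₂ c₃ c₄ : ℤ
        c₁ = U₁ ∙ f - δ * (μ * + 1)
        c₂ = U₁ ∙ g - δ * (μ * + 0)
        c₃ = U₂ ∙ f - δ * (μ * + 0)
        c₄ = U₂ ∙ g - δ * (μ * + 1)

        private
          regroup : ∀ δ x l s → δ * (x - l) + s ≡ δ * x + (s - δ * l)
          regroup = solve-∀

        -- Cramer's rule for the Schur complement of D, after eliminating the last m coordinates of the kernel vector.
        block-singular : ∀ A → context A ≡ c → IsEigenvalueℤ μ A →
          let ((y , z) , (x , w)) = block A in (δ * x + c₁) * (δ * w + c₄) ≡ (δ * y + c₂) * (δ * z + c₃)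
        block-singular A@((x ∷ y ∷ u) ∷ (z ∷ w ∷ v) ∷ rows) refl (e , (j₀ , e≢0) , eqs) =
            det2-zero (δ * x + c₁) (δ * y + c₂) (δ * z + c₃) (δ * w + c₄) a b (reduce x (μ * + 1) y (μ * + 0) U₁ (eqs zero))
              (reduce z (μ * + 0) w (μ * + 1) U₂ (eqs (suc zero))) ab≢0
          where
          a = e zero
          b = e (suc zero)
          q : Fin m → ℤ
          q j = e (ss j)
          sol : ∀ j → δ * q j ≡ f j * a + g j * b
          sol = solution a b q λ i → trans (ℤₚ.+-assoc (V i * a) (W i * b) (D i ∙ q)) (eqs (ss i))
          reduce : ∀ x l y l′ (U : Fin m → ℤ) → (x - l) * a + ((y - l′) * b + U ∙ q) ≡ + 0 →
            (δ * x + (U ∙ f - δ * l)) * a + (δ * y + (U ∙ g - δ * l′)) * b ≡ + 0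
          reduce x l y l′ U eq =
            trans (collect δ x l y l′ a b (U ∙ f) (U ∙ g))
            (trans (cong (λ t → δ * ((x - l) * a + (y - l′) * b) + t)
                     (trans (sym (∙-linʳ a b U f g)) (trans (sum-cong-≗ λ j → cong (U j *_) (sym (sol j))) (∙-scaleʳ δ U q))))
            (trans (factor δ ((x - l) * a) ((y - l′) * b) (U ∙ q)) (trans (cong (δ *_) eq) (ℤₚ.*-zeroʳ δ))))
            where
            collect : ∀ δ x l y l′ a b s t → (δ * x + (s - δ * l)) * a + (δ * y + (t - δ * l′)) * b ≡
              δ * ((x - l) * a + (y - l′) * b) + (s * a + t * b)
            collect = solve-∀
            factor : ∀ δ p q r → δ * (p + q) + δ * r ≡ δ * (p + (q + r))
            factor = solve-∀
          -- If a and b vanished, δq = fa + gb and δ ≠ 0 would make the whole kernel vector zero.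
          ab≢0 : a ≢ + 0 ⊎ b ≢ + 0
          ab≢0 with a ℤₚ.≟ + 0 | b ℤₚ.≟ + 0
          ... | no a≢0 | _ = inj₁ a≢0
          ... | yes _ | no b≢0 = inj₂ b≢0
          ... | yes a≡0 | yes b≡0 = contradiction (e≡0 j₀) e≢0
            where
            zeros : ∀ f g → f * + 0 + g * + 0 ≡ + 0
            zeros = solve-∀
            e≡0 : ∀ j → e j ≡ + 0
            e≡0 zero = a≡0
            e≡0 (suc zero) = b≡0
            e≡0 (suc (suc j)) = *-cancelˡ-≢0 δ δ≢0 (trans (sol j) (trans (cong₂ (λ s t → f j * s + g j * t) a≡0 b≡0)
              (trans (zeros (f j) (g j)) (sym (ℤₚ.*-zeroʳ δ)))))

        -- The off-diagonal factors are the ones to bound, because their product is the integer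
        -- whose divisors are counted. Moving δμ·0 back into the entry leaves a product of size BH
        -- and an inner product of size mHB, together `R`.
        off-diagonal≤ : ∀ (U h : Fin m → ℤ) {x} → (∀ j → ∣ U j ∣ ≤ H) → (∀ j → ∣ h j ∣ ≤ B) → InI k x →
          ∣ δ * x + (U ∙ h - δ * (μ * + 0)) ∣ ≤ R
        off-diagonal≤ U h {x} U≤ h≤ x∈ = subst (λ t → ∣ t ∣ ≤ R) (regroup δ x (μ * + 0) (U ∙ h))
          (∣+∣≤ (δ * (x - μ * + 0)) (U ∙ h)
            (subst (∣ δ * (x - μ * + 0) ∣ ≤_) (ℕₚ.*-comm B H) (∣*∣≤ δ (x - μ * + 0) ∣δ∣≤ (entry≤ (+ 0) z≤n x∈)))
            (∣∙∣≤ U h U≤ h≤))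

      generic-≲ : ∀ {T} → (∀ N → 1 ≤ N → N ≤ R ℕ.* R → (_∣ N) ≲ T) →
        -- The `Solved` record depends on the context alone, so including it in `Q` provides the
        -- same δ, f and g for every block in a fibre.
        (λ A → Eigen (2 ℕ.+ m) k μ A × SolvedContext (context A)) ≲
          ((K ℕ.^ m ℕ.* K ℕ.^ m) ℕ.* (K ℕ.^ (2 ℕ.+ m)) ℕ.^ m) ℕ.*
          ((K ℕ.* K) ℕ.* (T ℕ.+ T) ℕ.+ (K ℕ.+ K) ℕ.* (K ℕ.+ K))
      generic-≲ {T} div = ≲-fiber _≟ᶜ_ context {Q = λ c → InContext k c × SolvedContext c}
          (λ { ((bA , _) , S) → inContext bA , S }) (≲-mono proj₁ ℕₚ.≤-refl (InContext-≲ k)) fibre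
        where
        inContext : ∀ {A} → InM (2 ℕ.+ m) k A → InContext k (context A)
        inContext {(x ∷ y ∷ u) ∷ (z ∷ w ∷ v) ∷ rows} ((_ ∷ _ ∷ bu) ∷ (_ ∷ _ ∷ bv) ∷ bs) = (bu , bv) , bs
        fibre : ∀ c → InContext k c × SolvedContext c →
          (λ A → (Eigen (2 ℕ.+ m) k μ A × SolvedContext (context A)) × context A ≡ c) ≲
            ((K ℕ.* K) ℕ.* (T ℕ.+ T) ℕ.+ (K ℕ.+ K) ℕ.* (K ℕ.+ K))
        fibre c@((u , v) , rows) (((bu , bv) , _) , S) =
            ≲-inj (×-≡-dec (×-≡-dec ℤₚ._≟_ ℤₚ._≟_) (×-≡-dec ℤₚ._≟_ ℤₚ._≟_)) block
            {Q = SingularBlock δ δ≢0 k (c₁ c S) (c₂ c S) (c₃ c S) (c₄ c S)}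
            inBlock (λ { (_ , e) (_ , e′) → context-block-injective (trans e (sym e′)) })
            (singular-blocks-≲ δ δ≢0 k _ _ _ _
              (off-diagonal≤ c S U₁ g (λ j → entry≤ (+ 0) z≤n (VAllₚ.lookup⁺ bu j)) ∣g∣≤)
              (off-diagonal≤ c S U₂ f (λ j → entry≤ (+ 0) z≤n (VAllₚ.lookup⁺ bv j)) ∣f∣≤) div)
          where
          open Solved S
          open Columns μ c
          inBlock : ∀ {A} → (Eigen (2 ℕ.+ m) k μ A × SolvedContext (context A)) × context A ≡ c →
            SingularBlock δ δ≢0 k (c₁ c S) (c₂ c S) (c₃ c S) (c₄ c S) (block A)
          inBlock {A@((x ∷ y ∷ u) ∷ (z ∷ w ∷ v) ∷ rows)} (((((bx ∷ by ∷ _) ∷ (bz ∷ bw ∷ _) ∷ _) , eig) , _) , e) =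
            (by , bz) , (bx , bw) , block-singular c S A e eig

      -- The count `M` for singular D stays a parameter: it comes from the induction in general and
      -- from a separate computation for size 3.
      eigen-≲ : ∀ {T M} → (∀ N → 1 ≤ N → N ≤ R ℕ.* R → (_∣ N) ≲ T) →
        (λ A → Eigen (2 ℕ.+ m) k μ A × IsEigenvalueℤ μ (corner A)) ≲ M →
        Eigen (2 ℕ.+ m) k μ ≲ M ℕ.+ ((K ℕ.^ m ℕ.* K ℕ.^ m) ℕ.* (K ℕ.^ (2 ℕ.+ m)) ℕ.^ m) ℕ.*
          ((K ℕ.* K) ℕ.* (T ℕ.+ T) ℕ.+ (K ℕ.+ K) ℕ.* (K ℕ.+ K))
      eigen-≲ div bad = ≲-union split bad (generic-≲ div)
        where
        split : ∀ {A} → Eigen (2 ℕ.+ m) k μ A →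
          (Eigen (2 ℕ.+ m) k μ A × IsEigenvalueℤ μ (corner A)) ⊎ (Eigen (2 ℕ.+ m) k μ A × SolvedContext (context A))
        split {A@((x ∷ y ∷ u) ∷ (z ∷ w ∷ v) ∷ rows)} p@(((_ ∷ _ ∷ bu) ∷ (_ ∷ _ ∷ bv) ∷ bs) , _)
          with solve-context (context A) ((bu , bv) , bs)
        ... | inj₁ ker = inj₁ (p , corner-eigenvalue μ A ker)
        ... | inj₂ S = inj₂ (p , S)

open FixedEigenvalue

-- Size 3 with a 1 × 1 singular corner

module ThreeByThree where
  open import Data.Integer using (+_; _+_; _*_; _-_)
  open import Data.Integer.Tactic.RingSolver using (solve-∀)
  open import Data.Fin.Patterns using (0F; 1F; 2F)
  open import Data.Vec.Relation.Unary.All using (All; []; _∷_)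

  det3 : (a b c d e f g h i : ℤ) → ℤ
  det3 a b c d e f g h i = a * (e * i - f * h) - b * (d * i - f * g) + c * (d * h - e * g)

  -- The identity adj(B) B = det(B) applied to the kernel vector: every coordinate times the
  -- determinant vanishes, and a nonzero coordinate can be cancelled. The trailing `+ 0` in the
  -- identities matches the unfolded sums.
  det3-zero : (B : Fin 3 → Fin 3 → ℤ) → HasKernel B →
    det3 (B 0F 0F) (B 0F 1F) (B 0F 2F) (B 1F 0F) (B 1F 1F) (B 1F 2F) (B 2F 0F) (B 2F 1F) (B 2F 2F) ≡ + 0
  det3-zero B (v , (j , vj≢0) , eqs) = *-cancelˡ-≢0 (v j) vj≢0 (trans (vanish j) (sym (ℤₚ.*-zeroʳ (v j))))
    where
    a = B 0F 0F
    b = B 0F 1F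
    c = B 0F 2F
    d = B 1F 0F
    e = B 1F 1F
    f = B 1F 2F
    g = B 2F 0F
    h = B 2F 1F
    i = B 2F 2F
    cramer₀ : ∀ a b c d e f g h i x y z →
      x * (a * (e * i - f * h) - b * (d * i - f * g) + c * (d * h - e * g)) ≡
      (e * i - f * h) * (a * x + (b * y + (c * z + + 0))) - (b * i - c * h) * (d * x + (e * y + (f * z + + 0)))
        + (b * f - c * e) * (g * x + (h * y + (i * z + + 0)))
    cramer₀ = solve-∀
    cramer₁ : ∀ a b c d e f g h i x y z →
      y * (a * (e * i - f * h) - b * (d * i - f * g) + c * (d * h - e * g)) ≡
      (f * g - d * i) * (a * x + (b * y + (c * z + + 0))) - (c * g - a * i) * (d * x + (e * y + (f * z + + 0)))
        + (c * d - a * f) * (g * x + (h * y + (i * z + + 0)))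
    cramer₁ = solve-∀
    cramer₂ : ∀ a b c d e f g h i x y z →
      z * (a * (e * i - f * h) - b * (d * i - f * g) + c * (d * h - e * g)) ≡
      (d * h - e * g) * (a * x + (b * y + (c * z + + 0))) - (a * h - b * g) * (d * x + (e * y + (f * z + + 0)))
        + (a * e - b * d) * (g * x + (h * y + (i * z + + 0)))
    cramer₂ = solve-∀
    zeros : ∀ p q r → p * + 0 - q * + 0 + r * + 0 ≡ + 0
    zeros = solve-∀
    kill : ∀ p q r → p * (B 0F ∙ v) - q * (B 1F ∙ v) + r * (B 2F ∙ v) ≡ + 0
    kill p q r = trans (cong₂ (λ s t → p * s - q * t + r * (B 2F ∙ v)) (eqs 0F) (eqs 1F))
      (trans (cong (λ s → p * + 0 - q * + 0 + r * s) (eqs 2F)) (zeros p q r))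
    vanish : ∀ j → v j * det3 a b c d e f g h i ≡ + 0
    vanish 0F = trans (cramer₀ a b c d e f g h i (v 0F) (v 1F) (v 2F)) (kill (e * i - f * h) (b * i - c * h) (b * f - c * e))
    vanish 1F = trans (cramer₁ a b c d e f g h i (v 0F) (v 1F) (v 2F)) (kill (f * g - d * i) (c * g - a * i) (c * d - a * f))
    vanish 2F = trans (cramer₂ a b c d e f g h i (v 0F) (v 1F) (v 2F)) (kill (d * h - e * g) (a * h - b * g) (a * e - b * d))

  eigenvalue₁ : ∀ {μ r} → IsEigenvalueℤ μ ((r ∷ []) ∷ []) → r - μ * + 1 ≡ + 0
  eigenvalue₁ {μ} {r} (q , (0F , q≢0) , eqs) = *-cancelˡ-≢0 (q 0F) q≢0
    (trans (ℤₚ.*-comm (q 0F) (r - μ * + 1)) (trans (sym (ℤₚ.+-identityʳ _)) (trans (eqs 0F) (sym (ℤₚ.*-zeroʳ (q 0F))))))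

  module _ (k : ℕ) (μ : ℤ) where
    private K = 1 ℕ.+ 2 ℕ.* k

    -- After a₃₃ = μ the determinant of A - μ is affine in a₁₁, with slope -a₂₃a₃₂.
    degenerate₃-≲ : (λ A → Eigen 3 k μ A × IsEigenvalueℤ μ (corner A)) ≲ (K ℕ.^ 7 ℕ.+ (K ℕ.^ 7 ℕ.+ K ℕ.^ 7))
    degenerate₃-≲ = ≲-union (λ {A} → split {A})
        (≲-inj _≟ᵛ_ without-a₂₃ {Q = All (InI k)} inBox₁ inj₁′ box)
        (≲-union {Q = P₂} {R = P₃} (λ p → p)
          (≲-inj _≟ᵛ_ without-a₃₂ {Q = All (InI k)} inBox₂ inj₂′ box)
          (≲-inj _≟ᵛ_ without-a₁₁ {Q = All (InI k)} inBox₃ inj₃′ box))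
      where
      box = ≲-Vec ℤₚ._≟_ (InI-≲ k) 7
      a₁₁ a₂₃ a₃₂ a₃₃ : Mat ℤ 3 → ℤ
      a₁₁ ((x ∷ y ∷ u ∷ []) ∷ (z ∷ w ∷ v ∷ []) ∷ (s ∷ t ∷ r ∷ []) ∷ []) = x
      a₂₃ ((x ∷ y ∷ u ∷ []) ∷ (z ∷ w ∷ v ∷ []) ∷ (s ∷ t ∷ r ∷ []) ∷ []) = v
      a₃₂ ((x ∷ y ∷ u ∷ []) ∷ (z ∷ w ∷ v ∷ []) ∷ (s ∷ t ∷ r ∷ []) ∷ []) = t
      a₃₃ ((x ∷ y ∷ u ∷ []) ∷ (z ∷ w ∷ v ∷ []) ∷ (s ∷ t ∷ r ∷ []) ∷ []) = r
      without-a₂₃ without-a₃₂ without-a₁₁ : Mat ℤ 3 → Vec ℤ 7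
      without-a₂₃ ((x ∷ y ∷ u ∷ []) ∷ (z ∷ w ∷ v ∷ []) ∷ (s ∷ t ∷ r ∷ []) ∷ []) = x ∷ y ∷ u ∷ z ∷ w ∷ s ∷ t ∷ []
      without-a₃₂ ((x ∷ y ∷ u ∷ []) ∷ (z ∷ w ∷ v ∷ []) ∷ (s ∷ t ∷ r ∷ []) ∷ []) = x ∷ y ∷ u ∷ z ∷ w ∷ v ∷ s ∷ []
      without-a₁₁ ((x ∷ y ∷ u ∷ []) ∷ (z ∷ w ∷ v ∷ []) ∷ (s ∷ t ∷ r ∷ []) ∷ []) = y ∷ u ∷ z ∷ w ∷ v ∷ s ∷ t ∷ []
      affine : Mat ℤ 3 → ℤ
      affine ((x ∷ y ∷ u ∷ []) ∷ (z ∷ w ∷ v ∷ []) ∷ (s ∷ t ∷ r ∷ []) ∷ []) = y * v * s + u * (z * t - (w - μ) * s) + μ * (v * t)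
      -- Each case fixes a₃₃ and one further entry: a₂₃ = 0, a₃₂ = 0, or a₁₁ as the root of an
      -- affine equation with nonzero slope. This leaves seven free entries out of nine.
      P₁ P₂ P₃ : Mat ℤ 3 → Set
      P₁ A = InM 3 k A × a₃₃ A ≡ μ × a₂₃ A ≡ + 0
      P₂ A = InM 3 k A × a₃₃ A ≡ μ × a₃₂ A ≡ + 0
      P₃ A = InM 3 k A × a₃₃ A ≡ μ × a₂₃ A * a₃₂ A ≢ + 0 × a₂₃ A * a₃₂ A * a₁₁ A ≡ affine A
      inBox₁ : ∀ {A} → P₁ A → All (InI k) (without-a₂₃ A)
      inBox₁ {(x ∷ y ∷ u ∷ []) ∷ (z ∷ w ∷ v ∷ []) ∷ (s ∷ t ∷ r ∷ []) ∷ []} (((bx ∷ by ∷ bu ∷ []) ∷ (bz ∷ bw ∷ bv ∷ []) ∷ (bs ∷ bt ∷ br ∷ []) ∷ []) , _) =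
        bx ∷ by ∷ bu ∷ bz ∷ bw ∷ bs ∷ bt ∷ []
      inBox₂ : ∀ {A} → P₂ A → All (InI k) (without-a₃₂ A)
      inBox₂ {(x ∷ y ∷ u ∷ []) ∷ (z ∷ w ∷ v ∷ []) ∷ (s ∷ t ∷ r ∷ []) ∷ []} (((bx ∷ by ∷ bu ∷ []) ∷ (bz ∷ bw ∷ bv ∷ []) ∷ (bs ∷ bt ∷ br ∷ []) ∷ []) , _) =
        bx ∷ by ∷ bu ∷ bz ∷ bw ∷ bv ∷ bs ∷ []
      inBox₃ : ∀ {A} → P₃ A → All (InI k) (without-a₁₁ A)
      inBox₃ {(x ∷ y ∷ u ∷ []) ∷ (z ∷ w ∷ v ∷ []) ∷ (s ∷ t ∷ r ∷ []) ∷ []} (((bx ∷ by ∷ bu ∷ []) ∷ (bz ∷ bw ∷ bv ∷ []) ∷ (bs ∷ bt ∷ br ∷ []) ∷ []) , _) =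
        by ∷ bu ∷ bz ∷ bw ∷ bv ∷ bs ∷ bt ∷ []
      inj₁′ : ∀ {A B} → P₁ A → P₁ B → without-a₂₃ A ≡ without-a₂₃ B → A ≡ B
      inj₁′ {(x ∷ y ∷ u ∷ []) ∷ (z ∷ w ∷ v ∷ []) ∷ (s ∷ t ∷ r ∷ []) ∷ []} {(x′ ∷ y′ ∷ u′ ∷ []) ∷ (z′ ∷ w′ ∷ v′ ∷ []) ∷ (s′ ∷ t′ ∷ r′ ∷ []) ∷ []}
        (_ , refl , refl) (_ , refl , refl) refl = refl
      inj₂′ : ∀ {A B} → P₂ A → P₂ B → without-a₃₂ A ≡ without-a₃₂ B → A ≡ B
      inj₂′ {(x ∷ y ∷ u ∷ []) ∷ (z ∷ w ∷ v ∷ []) ∷ (s ∷ t ∷ r ∷ []) ∷ []} {(x′ ∷ y′ ∷ u′ ∷ []) ∷ (z′ ∷ w′ ∷ v′ ∷ []) ∷ (s′ ∷ t′ ∷ r′ ∷ []) ∷ []}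
        (_ , refl , refl) (_ , refl , refl) refl = refl
      inj₃′ : ∀ {A B} → P₃ A → P₃ B → without-a₁₁ A ≡ without-a₁₁ B → A ≡ B
      inj₃′ {(x ∷ y ∷ u ∷ []) ∷ (z ∷ w ∷ v ∷ []) ∷ (s ∷ t ∷ r ∷ []) ∷ []} {(x′ ∷ y′ ∷ u′ ∷ []) ∷ (z′ ∷ w′ ∷ v′ ∷ []) ∷ (s′ ∷ t′ ∷ r′ ∷ []) ∷ []}
        (_ , refl , vt≢0 , eq) (_ , refl , _ , eq′) refl with *-cancelˡ-≢0 (v * t) vt≢0 (trans eq (sym eq′))
      ... | refl = refl
      -- The subtracted expression is the determinant of A - μ with its last entry already replaced
      -- by 0, so it vanishes.
      isolate : ∀ x y u z w v s t μ → v * t * x ≡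
        y * v * s + u * (z * t - (w - μ) * s) + μ * (v * t) -
        ((x - μ * + 1) * ((w - μ * + 1) * + 0 - (v - μ * + 0) * (t - μ * + 0)) - (y - μ * + 0) * ((z - μ * + 0) * + 0 - (v - μ * + 0) * (s - μ * + 0))
          + (u - μ * + 0) * ((z - μ * + 0) * (t - μ * + 0) - (w - μ * + 1) * (s - μ * + 0)))
      isolate = solve-∀
      split : ∀ {A} → Eigen 3 k μ A × IsEigenvalueℤ μ (corner A) → P₁ A ⊎ (P₂ A ⊎ P₃ A)
      split {A@((x ∷ y ∷ u ∷ []) ∷ (z ∷ w ∷ v ∷ []) ∷ (s ∷ t ∷ r ∷ []) ∷ [])} ((bA , ker) , eig) = cases (v * t ℤₚ.≟ + 0)
        where
        r-μ≡0 : r - μ * + 1 ≡ + 0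
        r-μ≡0 = eigenvalue₁ {μ} eig
        r≡μ : r ≡ μ
        r≡μ = trans (ℤₚ.i-j≡0⇒i≡j r (μ * + 1) r-μ≡0) (ℤₚ.*-identityʳ μ)
        det≡0 : det3 (x - μ * + 1) (y - μ * + 0) (u - μ * + 0) (z - μ * + 0) (w - μ * + 1) (v - μ * + 0)
                     (s - μ * + 0) (t - μ * + 0) (+ 0) ≡ + 0
        det≡0 = trans (cong (det3 (x - μ * + 1) (y - μ * + 0) (u - μ * + 0) (z - μ * + 0) (w - μ * + 1) (v - μ * + 0)
                                  (s - μ * + 0) (t - μ * + 0)) (sym r-μ≡0))
          (det3-zero (shift μ A) ker)
        cases : Dec (v * t ≡ + 0) → P₁ A ⊎ (P₂ A ⊎ P₃ A)
        cases (no vt≢0) = inj₂ (inj₂ (bA , r≡μ , vt≢0 ,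
          trans (isolate x y u z w v s t μ) (trans (cong (λ d → affine A - d) det≡0) (ℤₚ.+-identityʳ (affine A)))))
        cases (yes vt≡0) with ℤₚ.i*j≡0⇒i≡0∨j≡0 v vt≡0
        ... | inj₁ v≡0 = inj₁ (bA , r≡μ , v≡0)
        ... | inj₂ t≡0 = inj₂ (inj₁ (bA , r≡μ , t≡0))

open ThreeByThree

-- Asymptotics: a fixed eigenvalue has probability O(k^ε / k²)

module CodimensionTwo where
  open import Data.Nat using (_+_; _*_; _^_)
  open import Data.Integer using (∣_∣)
  open ℕₚ
  open import Data.Nat.Divisibility using (_∣_)
  open import Data.Nat.Tactic.RingSolver using (solve-∀)

  m≤m^n : ∀ m n → 1 ≤ n → m ≤ m ^ n
  m≤m^n zero n _ = z≤n
  m≤m^n m@(suc _) n 1≤n = subst (_≤ m ^ n) (^-identityʳ m) (^-monoʳ-≤ m 1≤n)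

  -- The exponent is 2^c - 1. It depends on the matrix size alone, and `divisors-small` absorbs any
  -- fixed power.
  elimBound-monomial : ∀ c → ∃ λ a → ∃ λ e → ∀ H → elimBound c H ≡ a * H ^ e
  elimBound-monomial zero = 1 , 0 , λ H → refl
  elimBound-monomial (suc c) with elimBound-monomial c
  ... | a , e , eq = suc c * (a * 2 ^ e) , suc (e + e) , λ H → begin
      suc c * (H * elimBound c (2 * (H * H))) ≡⟨ cong (λ t → suc c * (H * t)) (eq (2 * (H * H))) ⟩
      suc c * (H * (a * (2 * (H * H)) ^ e))
        ≡⟨ cong (λ t → suc c * (H * (a * t))) (trans (^-distribʳ-* 2 (H * H) e) (cong (2 ^ e *_) (^-distribʳ-* H H e))) ⟩
      suc c * (H * (a * (2 ^ e * (H ^ e * H ^ e)))) ≡⟨ reorder (suc c) H a (2 ^ e) (H ^ e) ⟩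
      suc c * (a * 2 ^ e) * (H * (H ^ e * H ^ e))
        ≡⟨ cong (λ t → suc c * (a * 2 ^ e) * (H * t)) (sym (^-distribˡ-+-* H e e)) ⟩
      suc c * (a * 2 ^ e) * H ^ suc (e + e) ∎
    where
    open ≡-Reasoning
    reorder : ∀ c H a t h → c * (H * (a * (t * (h * h)))) ≡ c * (a * t) * (H * (h * h))
    reorder = solve-∀

  -- Bounds the two factors on the right of the block equation, for size 2 + m and entries of A - μ up to H.
  radius : ℕ → ℕ → ℕ
  radius m H = suc m * (H * elimBound m H)

  radius²-monomial : ∀ m h → ∃ λ c → ∃ λ e → 1 ≤ e × ∀ k → radius m (h * k) * radius m (h * k) ≡ c * k ^ e
  radius²-monomial m h with elimBound-monomial m
  ... | a , e , eq = b * b , suc e + suc e , s≤s z≤n , λ k → begin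
      radius m (h * k) * radius m (h * k) ≡⟨ cong (λ t → t * t) (single k) ⟩
      b * k ^ suc e * (b * k ^ suc e) ≡⟨ reorder b (k ^ suc e) ⟩
      b * b * (k ^ suc e * k ^ suc e) ≡⟨ cong (b * b *_) (sym (^-distribˡ-+-* k (suc e) (suc e))) ⟩
      b * b * k ^ (suc e + suc e) ∎
    where
    open ≡-Reasoning
    b = suc m * (a * h ^ suc e)
    reorder : ∀ b x → b * x * (b * x) ≡ b * b * (x * x)
    reorder = solve-∀
    reorder′ : ∀ m H a x → m * (H * (a * x)) ≡ m * (a * (H * x))
    reorder′ = solve-∀
    reorder″ : ∀ m a x y → m * (a * (x * y)) ≡ m * (a * x) * y
    reorder″ = solve-∀
    single : ∀ k → radius m (h * k) ≡ b * k ^ suc e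
    single k = begin
      suc m * (h * k * elimBound m (h * k)) ≡⟨ cong (λ t → suc m * (h * k * t)) (eq (h * k)) ⟩
      suc m * (h * k * (a * (h * k) ^ e)) ≡⟨ reorder′ (suc m) (h * k) a ((h * k) ^ e) ⟩
      suc m * (a * (h * k) ^ suc e) ≡⟨ cong (λ t → suc m * (a * t)) (^-distribʳ-* h k (suc e)) ⟩
      suc m * (a * (h ^ suc e * k ^ suc e)) ≡⟨ reorder″ (suc m) a (h ^ suc e) (k ^ suc e) ⟩
      b * k ^ suc e ∎

  module _ (p q : ℕ) (1≤p : 1 ≤ p) (1≤q : 1 ≤ q) where

    -- G = O(k^(p/q)) with constant C.
    Small : ℕ → ℕ → ℕ → Set
    Small C k G = G ^ q ≤ C ^ q * k ^ p

    small-const : ∀ C {k} → 1 ≤ k → Small C k C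
    small-const C {k} 1≤k = m≤m*n (C ^ q) (k ^ p) {{ℕ.>-nonZero (1≤^ p 1≤k)}}

    -- The sum is at most twice the larger summand, which brings its own constant; no expansion of
    -- the q-th power is involved.
    small-+ : ∀ {C D k G H} → Small C k G → Small D k H → Small (2 * (C + D)) k (G + H)
    small-+ {C} {D} {k} {G} {H} sG sH = [ left , right ]′ (≤-total H G)
      where
  
      open ≤-Reasoning
      double : ∀ {X Y} → Y ≤ C + D → X ^ q ≤ Y ^ q * k ^ p → G + H ≤ 2 * X → (G + H) ^ q ≤ (2 * (C + D)) ^ q * k ^ p
      double {X} {Y} Y≤ sX ≤2X = begin
        (G + H) ^ q ≤⟨ ^-monoˡ-≤ q ≤2X ⟩
        (2 * X) ^ q ≡⟨ ^-distribʳ-* 2 X q ⟩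
        2 ^ q * X ^ q ≤⟨ *-monoʳ-≤ (2 ^ q) sX ⟩
        2 ^ q * (Y ^ q * k ^ p) ≡⟨ sym (*-assoc (2 ^ q) (Y ^ q) (k ^ p)) ⟩
        2 ^ q * Y ^ q * k ^ p ≡⟨ cong (_* k ^ p) (sym (^-distribʳ-* 2 Y q)) ⟩
        (2 * Y) ^ q * k ^ p ≤⟨ *-monoˡ-≤ (k ^ p) (^-monoˡ-≤ q (*-monoʳ-≤ 2 Y≤)) ⟩
        (2 * (C + D)) ^ q * k ^ p ∎
      twice : ∀ {x y z} → x ≤ z → y ≤ z → x + y ≤ 2 * z
      twice {z = z} x≤z y≤z = ≤-trans (+-mono-≤ x≤z y≤z) (≤-reflexive (cong (z +_) (sym (+-identityʳ z))))
      left : H ≤ G → Small (2 * (C + D)) k (G + H)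
      left H≤G = double {G} {C} (m≤m+n C D) sG (twice ≤-refl H≤G)
      right : G ≤ H → Small (2 * (C + D)) k (G + H)
      right G≤H = double {H} {D} (m≤n+m D C) sH (twice G≤H ≤-refl)

    -- If R² = ck^e, the divisor bound is taken with s = qe: then T^(qe) ≤ C c k^e, and an e-th root
    -- gives T^q ≤ C c k, at most (Cc)^q k^p because p, q ≥ 1.
    divisors-small : ∀ m h → ∃ λ C → ∀ k → 1 ≤ k →
      ∃ λ T → Small C k T × (∀ N → 1 ≤ N → N ≤ radius m (h * k) * radius m (h * k) → (_∣ N) ≲ T)
    divisors-small m h with radius²-monomial m h
    ... | c , e , 1≤e , mono with divisors-≲ (q * e) (*-mono-≤ 1≤q 1≤e)
    ... | C , div = C * c , λ k 1≤k → bound k 1≤k (div (radius m (h * k) * radius m (h * k)))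
      where
      bound : ∀ k → 1 ≤ k →
        (∃ λ T → T ^ (q * e) ≤ C * (radius m (h * k) * radius m (h * k)) ×
          (∀ N → 1 ≤ N → N ≤ radius m (h * k) * radius m (h * k) → (_∣ N) ≲ T)) → _
      bound k 1≤k (T , T≤ , count) = T , small , count
        where
        open ≤-Reasoning
        root : T ^ q ≤ C * c * k
        root = ^-cancelʳ-≤ e 1≤e (begin
          (T ^ q) ^ e ≡⟨ ^-*-assoc T q e ⟩
          T ^ (q * e) ≤⟨ T≤ ⟩
          C * (radius m (h * k) * radius m (h * k)) ≡⟨ cong (C *_) (mono k) ⟩
          C * (c * k ^ e) ≡⟨ sym (*-assoc C c (k ^ e)) ⟩
          C * c * k ^ e ≤⟨ *-monoˡ-≤ (k ^ e) (m≤m^n (C * c) e 1≤e) ⟩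
          (C * c) ^ e * k ^ e ≡⟨ sym (^-distribʳ-* (C * c) k e) ⟩
          (C * c * k) ^ e ∎)
        small : Small (C * c) k T
        small = ≤-trans root (*-mono-≤ (m≤m^n (C * c) q 1≤q) (m≤m^n k p 1≤p))

    -- Up to the small factor G, the predicate holds with probability at most 1/K².
    record CountBound (n C k : ℕ) (P : ℤ → Mat ℤ n → Set) (ℓ : ℕ) : Set where
      constructor countBound
      K = 1 + 2 * k
      field
        G N : ℕ
        small : Small C k G
        N≤ : N * (K * K) ≤ G * K ^ (n * n)
        count : ∀ μ → ∣ μ ∣ ≤ ℓ * k → P μ ≲ N

    -- The range of μ is governed by ℓ and not by n: the induction descends to smaller corners,
    -- while μ still ranges over the possible eigenvalues of the original matrix.
    CodimTwo : (n ℓ : ℕ) → (ℕ → ℤ → Mat ℤ n → Set) → Set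
    CodimTwo n ℓ P = ∃ λ C → ∀ k → 1 ≤ k → CountBound n C k (P k) ℓ

    Degenerate : ∀ m → ℕ → ℤ → Mat ℤ (2 + m) → Set
    Degenerate m k μ A = Eigen (2 + m) k μ A × IsEigenvalueℤ μ (corner A)

    codimTwo-step : ∀ m ℓ → CodimTwo (2 + m) ℓ (Degenerate m) → CodimTwo (2 + m) ℓ (Eigen (2 + m))
    -- The entries of A - μ are at most k + |μ| ≤ (1 + ℓ)k.
    codimTwo-step m ℓ (C , bad) with divisors-small m (1 + ℓ)
    ... | C′ , div = _ , λ k 1≤k → combine k 1≤k (bad k 1≤k) (div k 1≤k)
      where
      combine : ∀ k → 1 ≤ k → CountBound (2 + m) C k (Degenerate m k) ℓ → _ →
        CountBound (2 + m) (2 * (C + 2 * (2 * (C′ + C′) + 4))) k (Eigen (2 + m) k) ℓ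
      combine k 1≤k (countBound G N small N≤ count) (T , smallT , countT) = record
        -- `T + T` comes from the blocks with nonzero right-hand side, 4 from the (2K)² blocks where
        -- it vanishes; `G` is inherited from the degenerate matrices.
        { G = G + (T + T + 4) ; N = _
        ; small = small-+ {C} {D = 2 * (2 * (C′ + C′) + 4)} {H = T + T + 4} small
                    (small-+ {C = 2 * (C′ + C′)} {D = 4} {G = T + T} (small-+ {C′} {C′} smallT smallT) (small-const 4 1≤k))
        ; N≤ = N≤′
        ; count = λ μ ∣μ∣≤ → eigen-≲ k ((1 + ℓ) * k) μ (+-monoʳ-≤ k ∣μ∣≤) countT (count μ ∣μ∣≤) }
        where
        K = 1 + 2 * k
        open ≤-Reasoning
        exponent : ∀ m → m + m + (2 + m) * m + 4 ≡ (2 + m) * (2 + m)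
        exponent = solve-∀
        collect : ∀ x y K T → x * x * y * ((K * K) * (T + T) + (K + K) * (K + K)) * (K * K) ≡
          (T + T + 4) * (x * x * y * (K * (K * (K * (K * 1)))))
        collect = solve-∀
        total : K ^ m * K ^ m * (K ^ (2 + m)) ^ m * K ^ 4 ≡ K ^ ((2 + m) * (2 + m))
        total = begin-equality
          K ^ m * K ^ m * (K ^ (2 + m)) ^ m * K ^ 4
            ≡⟨ cong₂ (λ s t → s * t * K ^ 4) (sym (^-distribˡ-+-* K m m)) (^-*-assoc K (2 + m) m) ⟩
          K ^ (m + m) * K ^ ((2 + m) * m) * K ^ 4 ≡⟨ cong (_* K ^ 4) (sym (^-distribˡ-+-* K (m + m) ((2 + m) * m))) ⟩
          K ^ (m + m + (2 + m) * m) * K ^ 4 ≡⟨ sym (^-distribˡ-+-* K (m + m + (2 + m) * m) 4) ⟩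
          K ^ (m + m + (2 + m) * m + 4) ≡⟨ cong (K ^_) (exponent m) ⟩
          K ^ ((2 + m) * (2 + m)) ∎
        rest = (K ^ m * K ^ m) * (K ^ (2 + m)) ^ m * ((K * K) * (T + T) + (K + K) * (K + K))
        N≤′ : (N + rest) * (K * K) ≤ (G + (T + T + 4)) * K ^ ((2 + m) * (2 + m))
        N≤′ = begin
          (N + rest) * (K * K) ≡⟨ *-distribʳ-+ (K * K) N rest ⟩
          N * (K * K) + rest * (K * K)
            ≤⟨ +-mono-≤ N≤ (≤-reflexive (trans (collect (K ^ m) ((K ^ (2 + m)) ^ m) K T) (cong ((T + T + 4) *_) total))) ⟩
          G * K ^ ((2 + m) * (2 + m)) + (T + T + 4) * K ^ ((2 + m) * (2 + m))
            ≡⟨ sym (*-distribʳ-+ (K ^ ((2 + m) * (2 + m))) G (T + T + 4)) ⟩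
          (G + (T + T + 4)) * K ^ ((2 + m) * (2 + m)) ∎

    degenerate : ∀ m ℓ → CodimTwo m ℓ (Eigen m) → CodimTwo (2 + m) ℓ (Degenerate m)
    degenerate m ℓ (C , eig) = C , λ k 1≤k → lift k (eig k 1≤k)
      where
      lift : ∀ k → CountBound m C k (Eigen m k) ℓ → CountBound (2 + m) C k (Degenerate m k) ℓ
      lift k (countBound G N small N≤ count) = record
        { G = G ; N = N * F ; small = small ; N≤ = N≤′
        ; count = λ μ ∣μ∣≤ → ≲-mono (λ { ((bA , _) , e) → bA , e }) ≤-refl (corner-≲ {P = IsEigenvalueℤ μ} (count μ ∣μ∣≤)) }
        where
        K = 1 + 2 * k
        F = (K ^ (2 + m)) ^ 2 * (K ^ 2) ^ m
        open ≤-Reasoning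
        exponent : ∀ m → m * m + ((2 + m) * 2 + 2 * m) ≡ (2 + m) * (2 + m)
        exponent = solve-∀
        swap : ∀ x y z → x * y * z ≡ x * z * y
        swap = solve-∀
        N≤′ : N * F * (K * K) ≤ G * K ^ ((2 + m) * (2 + m))
        N≤′ = begin
          N * F * (K * K) ≡⟨ swap N F (K * K) ⟩
          N * (K * K) * F ≤⟨ *-monoˡ-≤ F N≤ ⟩
          G * K ^ (m * m) * F ≡⟨ *-assoc G (K ^ (m * m)) F ⟩
          G * (K ^ (m * m) * F)
            ≡⟨ cong (λ t → G * (K ^ (m * m) * t)) (trans (cong₂ _*_ (^-*-assoc K (2 + m) 2) (^-*-assoc K 2 m)) (sym (^-distribˡ-+-* K ((2 + m) * 2) (2 * m)))) ⟩
          G * (K ^ (m * m) * K ^ ((2 + m) * 2 + 2 * m))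
            ≡⟨ cong (G *_) (trans (sym (^-distribˡ-+-* K (m * m) ((2 + m) * 2 + 2 * m))) (cong (K ^_) (exponent m))) ⟩
          G * K ^ ((2 + m) * (2 + m)) ∎

    degenerate₃ : ∀ ℓ → CodimTwo 3 ℓ (Degenerate 1)
    degenerate₃ ℓ = 3 , λ k 1≤k → record
      { G = 3 ; N = _ ; small = small-const 3 1≤k ; N≤ = ≤-reflexive (three (1 + 2 * k)) ; count = λ μ _ → degenerate₃-≲ k μ }
      where
      collect : ∀ x K → (x + (x + x)) * (K * K) ≡ 3 * (x * (K * (K * 1)))
      collect = solve-∀
      three : ∀ K → (K ^ 7 + (K ^ 7 + K ^ 7)) * (K * K) ≡ 3 * K ^ 9
      three K = trans (collect (K ^ 7) K) (cong (3 *_) (sym (^-distribˡ-+-* K 7 2)))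

    eigen-codimTwo : ∀ n ℓ → 2 ≤ n → CodimTwo n ℓ (Eigen n)
    -- The corner has size 0, and a vector without coordinates has no nonzero one, so the degenerate
    -- case is empty.
    eigen-codimTwo 2 ℓ _ = codimTwo-step 0 ℓ (degenerate 0 ℓ
      (0 , λ k 1≤k → record { G = 0 ; N = 0 ; small = small-const 0 1≤k ; N≤ = z≤n ; count = λ μ _ → ≲-none λ { (_ , _ , (() , _) , _) } }))
    eigen-codimTwo 3 ℓ _ = codimTwo-step 1 ℓ (degenerate₃ ℓ)
    eigen-codimTwo (suc (suc m@(suc (suc _)))) ℓ _ =
      codimTwo-step m ℓ (degenerate m ℓ (eigen-codimTwo m ℓ (s≤s (s≤s z≤n))))
    eigen-codimTwo 1 ℓ (s≤s ())

open CodimensionTwo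

-- Rational and integer eigenvalues, and diagonalizability

module RationalEigenvalues where
  open import Data.Integer using (+_; ∣_∣; _+_; _*_; _-_)
  import Data.Nat.Divisibility as ℕ∣
  open import Data.Nat.Coprimality as Coprime using (Coprime; coprime-divisor)
  open import Data.Nat.Induction using (<-rec)
  open import Data.Integer.Divisibility.Signed using (∣ᵤ⇒∣; divides)
  open import Data.Integer.Tactic.RingSolver using (solve-∀)
  open import Algebra.Properties.Semiring.Sum ℤₚ.+-*-semiring using (sum-cong-≗)
  open import Algebra.Bundles using (CommutativeRing)
  open import Data.Rational as ℚ using (ℚ; mkℚ; 0ℚ; 1ℚ; ↥_; ↧_; ↧ₙ_; toℚᵘ)
  import Data.Rational.Properties as ℚₚ
  open import Data.Rational.Unnormalised as ℚᵘ using (mkℚᵘ; *≡*)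
  import Data.Rational.Unnormalised.Properties as ℚᵘₚ
  import Algebra.Properties.Semiring.Sum (CommutativeRing.semiring ℚₚ.+-*-commutativeRing) as ℚΣ
  open import Data.Fin.Properties using (any?)

  toℚᵘ-toℚ : ∀ z → toℚᵘ (toℚ z) ℚᵘ.≃ mkℚᵘ z 0
  toℚᵘ-toℚ z = ℚₚ.toℚᵘ-fromℚᵘ (mkℚᵘ z 0)

  toℚ-injective : ∀ {a b} → toℚ a ≡ toℚ b → a ≡ b
  toℚ-injective {a} {b} eq with ℚᵘₚ.≃-trans (ℚᵘₚ.≃-sym (toℚᵘ-toℚ a)) (ℚᵘₚ.≃-trans (ℚᵘₚ.≃-reflexive (cong toℚᵘ eq)) (toℚᵘ-toℚ b))
  ... | *≡* e = trans (sym (ℤₚ.*-identityʳ a)) (trans e (ℤₚ.*-identityʳ b))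

  toℚ-+ : ∀ a b → toℚ (a + b) ≡ toℚ a ℚ.+ toℚ b
  toℚ-+ a b = ℚₚ.toℚᵘ-injective (ℚᵘₚ.≃-trans (toℚᵘ-toℚ (a + b)) (ℚᵘₚ.≃-trans (*≡* (eq a b))
      (ℚᵘₚ.≃-sym (ℚᵘₚ.≃-trans (ℚₚ.toℚᵘ-homo-+ (toℚ a) (toℚ b)) (ℚᵘₚ.+-cong (toℚᵘ-toℚ a) (toℚᵘ-toℚ b))))))
    where
    eq : ∀ a b → (a + b) * + 1 ≡ (a * + 1 + b * + 1) * + 1
    eq = solve-∀

  toℚ-* : ∀ a b → toℚ (a * b) ≡ toℚ a ℚ.* toℚ b
  toℚ-* a b = ℚₚ.toℚᵘ-injective (ℚᵘₚ.≃-trans (toℚᵘ-toℚ (a * b)) (ℚᵘₚ.≃-trans (*≡* refl)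
      (ℚᵘₚ.≃-sym (ℚᵘₚ.≃-trans (ℚₚ.toℚᵘ-homo-* (toℚ a) (toℚ b)) (ℚᵘₚ.*-cong (toℚᵘ-toℚ a) (toℚᵘ-toℚ b))))))

  toℚ-↧ : ∀ r → toℚ (↧ r) ℚ.* r ≡ toℚ (↥ r)
  toℚ-↧ r@(mkℚ n d-1 _) = ℚₚ.toℚᵘ-injective (ℚᵘₚ.≃-trans (ℚₚ.toℚᵘ-homo-* (toℚ (↧ r)) r)
      (ℚᵘₚ.≃-trans (ℚᵘₚ.*-cong (toℚᵘ-toℚ (↧ r)) (ℚᵘₚ.≃-refl {toℚᵘ r}))
      (ℚᵘₚ.≃-trans (*≡* (eq n (↧ r))) (ℚᵘₚ.≃-sym (toℚᵘ-toℚ n)))))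
    where
    eq : ∀ n d → (d * n) * + 1 ≡ n * (+ 1 * d)
    eq = solve-∀

  ℚ-swap : ∀ x y z → x ℚ.* (y ℚ.* z) ≡ y ℚ.* (x ℚ.* z)
  ℚ-swap x y z = trans (sym (ℚₚ.*-assoc x y z)) (trans (cong (ℚ._* z) (ℚₚ.*-comm x y)) (ℚₚ.*-assoc y x z))

  -- The multiplier constructed below is the product of all denominators. The last field carries
  -- non-vanishing over to the integer vector without cancellation in ℚ.
  record Cleared {n} (v : Vec ℚ n) : Set where
    field
      d : ℤ
      d≢0 : d ≢ + 0
      w : Fin n → ℤ
      w≡dv : ∀ i → toℚ (w i) ≡ toℚ d ℚ.* lookup v i
      w≡0⇒v≡0 : ∀ i → w i ≡ + 0 → lookup v i ≡ 0ℚ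

  clear-denominators : ∀ {n} (v : Vec ℚ n) → Cleared v
  clear-denominators [] = record { d = + 1 ; d≢0 = λ () ; w = λ () ; w≡dv = λ () ; w≡0⇒v≡0 = λ () }
  clear-denominators (r ∷ v) with clear-denominators v
  ... | record { d = d ; d≢0 = d≢0 ; w = w ; w≡dv = w≡dv ; w≡0⇒v≡0 = w≡0⇒v≡0 } = record
    { d = ↧ r * d ; d≢0 = ≢0-* {↧ r} {d} (λ ()) d≢0
    ; w = λ { zero → ↥ r * d ; (suc i) → ↧ r * w i }
    ; w≡dv = λ { zero → head ; (suc i) → tail i }
    ; w≡0⇒v≡0 = λ { zero eq → ℚₚ.↥p≡0⇒p≡0 r (*-cancelˡ-≢0 d d≢0 (trans (ℤₚ.*-comm d (↥ r)) (trans eq (sym (ℤₚ.*-zeroʳ d)))))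
                  ; (suc i) eq → w≡0⇒v≡0 i (*-cancelˡ-≢0 (↧ r) (λ ()) (trans eq (sym (ℤₚ.*-zeroʳ (↧ r))))) } }
    where
    open ≡-Reasoning
    head : toℚ (↥ r * d) ≡ toℚ (↧ r * d) ℚ.* r
    head = begin
      toℚ (↥ r * d) ≡⟨ toℚ-* (↥ r) d ⟩
      toℚ (↥ r) ℚ.* toℚ d ≡⟨ ℚₚ.*-comm (toℚ (↥ r)) (toℚ d) ⟩
      toℚ d ℚ.* toℚ (↥ r) ≡⟨ cong (toℚ d ℚ.*_) (sym (toℚ-↧ r)) ⟩
      toℚ d ℚ.* (toℚ (↧ r) ℚ.* r) ≡⟨ ℚ-swap (toℚ d) (toℚ (↧ r)) r ⟩
      toℚ (↧ r) ℚ.* (toℚ d ℚ.* r) ≡⟨ sym (ℚₚ.*-assoc (toℚ (↧ r)) (toℚ d) r) ⟩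
      toℚ (↧ r) ℚ.* toℚ d ℚ.* r ≡⟨ cong (ℚ._* r) (sym (toℚ-* (↧ r) d)) ⟩
      toℚ (↧ r * d) ℚ.* r ∎
    tail : ∀ i → toℚ (↧ r * w i) ≡ toℚ (↧ r * d) ℚ.* lookup v i
    tail i = begin
      toℚ (↧ r * w i) ≡⟨ toℚ-* (↧ r) (w i) ⟩
      toℚ (↧ r) ℚ.* toℚ (w i) ≡⟨ cong (toℚ (↧ r) ℚ.*_) (w≡dv i) ⟩
      toℚ (↧ r) ℚ.* (toℚ d ℚ.* lookup v i) ≡⟨ sym (ℚₚ.*-assoc (toℚ (↧ r)) (toℚ d) (lookup v i)) ⟩
      toℚ (↧ r) ℚ.* toℚ d ℚ.* lookup v i ≡⟨ cong (ℚ._* lookup v i) (sym (toℚ-* (↧ r) d)) ⟩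
      toℚ (↧ r * d) ℚ.* lookup v i ∎

  toℚ-∙ : ∀ {n} (r : Vec ℤ n) (v : Vec ℚ n) (w : Fin n → ℤ) d → (∀ i → toℚ (w i) ≡ d ℚ.* lookup v i) →
    toℚ (lookup r ∙ w) ≡ d ℚ.* dotℚ (Vec.map toℚ r) v
  toℚ-∙ [] [] w d eq = sym (ℚₚ.*-zeroʳ d)
  toℚ-∙ (x ∷ r) (y ∷ v) w d eq = begin
    toℚ (x * w zero + lookup r ∙ (w ∘ suc)) ≡⟨ toℚ-+ (x * w zero) (lookup r ∙ (w ∘ suc)) ⟩
    toℚ (x * w zero) ℚ.+ toℚ (lookup r ∙ (w ∘ suc))
      ≡⟨ cong₂ ℚ._+_ (trans (toℚ-* x (w zero)) (cong (toℚ x ℚ.*_) (eq zero))) (toℚ-∙ r v (w ∘ suc) d (eq ∘ suc)) ⟩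
    toℚ x ℚ.* (d ℚ.* y) ℚ.+ d ℚ.* dotℚ (Vec.map toℚ r) v
      ≡⟨ cong (ℚ._+ d ℚ.* dotℚ (Vec.map toℚ r) v) (ℚ-swap (toℚ x) d y) ⟩
    d ℚ.* (toℚ x ℚ.* y) ℚ.+ d ℚ.* dotℚ (Vec.map toℚ r) v
      ≡⟨ sym (ℚₚ.*-distribˡ-+ d (toℚ x ℚ.* y) (dotℚ (Vec.map toℚ r) v)) ⟩
    d ℚ.* (toℚ x ℚ.* y ℚ.+ dotℚ (Vec.map toℚ r) v) ∎
    where open ≡-Reasoning

  vec-ext : ∀ {A : Set} {n} {u v : Vec A n} → (∀ i → lookup u i ≡ lookup v i) → u ≡ v
  vec-ext {u = u} {v} eq = trans (sym (Vecₚ.tabulate∘lookup u)) (trans (Vecₚ.tabulate-cong eq) (Vecₚ.tabulate∘lookup v))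

  -- Writing the eigenvalue as a/b serves two purposes: b = 1 for integer eigenvalues, and b the
  -- reduced denominator in the proof that rational ones are integers.
  integer-eigenvector : ∀ {n} (A : Mat ℤ n) r a b → toℚ b ℚ.* r ≡ toℚ a → IsEigenvalue A r →
    Σ (Fin n → ℤ) λ w → (∃ λ i → w i ≢ + 0) × (∀ i → b * (lookup (lookup A i) ∙ w) ≡ a * w i)
  integer-eigenvector {n} A r a b br≡a (v , v≢0 , Av≡rv) = w , nonzero , λ i → toℚ-injective (row i)
    where
    open Cleared (clear-denominators v)
    open ≡-Reasoning
    nonzero : ∃ λ i → w i ≢ + 0
    nonzero with any? (λ i → ¬? (w i ℤₚ.≟ + 0))
    ... | yes p = p
    ... | no none = contradiction (vec-ext λ i → trans (w≡0⇒v≡0 i (decidable-stable (w i ℤₚ.≟ + 0) λ ne → none (i , ne)))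
                      (sym (Vecₚ.lookup-replicate i 0ℚ))) v≢0
    eigen : ∀ i → dotℚ (Vec.map toℚ (lookup A i)) v ≡ r ℚ.* lookup v i
    eigen i = begin
      dotℚ (Vec.map toℚ (lookup A i)) v ≡⟨ cong (λ row → dotℚ row v) (sym (Vecₚ.lookup-map i (Vec.map toℚ) A)) ⟩
      dotℚ (lookup (toℚMat A) i) v ≡⟨ sym (Vecₚ.lookup-map i (λ row → dotℚ row v) (toℚMat A)) ⟩
      lookup (toℚMat A ·ᵥ v) i ≡⟨ cong (λ u → lookup u i) Av≡rv ⟩
      lookup (Vec.map (r ℚ.*_) v) i ≡⟨ Vecₚ.lookup-map i (r ℚ.*_) v ⟩
      r ℚ.* lookup v i ∎
    row : ∀ i → toℚ (b * (lookup (lookup A i) ∙ w)) ≡ toℚ (a * w i)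
    row i = begin
      toℚ (b * (lookup (lookup A i) ∙ w)) ≡⟨ toℚ-* b _ ⟩
      toℚ b ℚ.* toℚ (lookup (lookup A i) ∙ w) ≡⟨ cong (toℚ b ℚ.*_) (toℚ-∙ (lookup A i) v w (toℚ d) w≡dv) ⟩
      toℚ b ℚ.* (toℚ d ℚ.* dotℚ (Vec.map toℚ (lookup A i)) v) ≡⟨ cong (λ t → toℚ b ℚ.* (toℚ d ℚ.* t)) (eigen i) ⟩
      toℚ b ℚ.* (toℚ d ℚ.* (r ℚ.* lookup v i)) ≡⟨ cong (toℚ b ℚ.*_) (ℚ-swap (toℚ d) r (lookup v i)) ⟩
      toℚ b ℚ.* (r ℚ.* (toℚ d ℚ.* lookup v i)) ≡⟨ sym (ℚₚ.*-assoc (toℚ b) r _) ⟩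
      toℚ b ℚ.* r ℚ.* (toℚ d ℚ.* lookup v i) ≡⟨ cong₂ ℚ._*_ br≡a (sym (w≡dv i)) ⟩
      toℚ a ℚ.* toℚ (w i) ≡⟨ sym (toℚ-* a (w i)) ⟩
      toℚ (a * w i) ∎

  integer-eigenvalue : ∀ {n} (A : Mat ℤ n) μ → IsEigenvalue A (toℚ μ) → IsEigenvalueℤ μ A
  integer-eigenvalue A μ eig with integer-eigenvector A (toℚ μ) μ (+ 1) (ℚₚ.*-identityˡ (toℚ μ)) eig
  ... | w , nonzero , rows = w , nonzero , λ i → begin
      shift μ A i ∙ w
        ≡⟨ sum-cong-≗ (λ j → cong (λ t → (t - μ * kronecker i j) * w j) (sym (ℤₚ.*-identityˡ (lookup (lookup A i) j)))) ⟩
      (λ j → + 1 * lookup (lookup A i) j - μ * kronecker i j) ∙ w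
        ≡⟨ ∙-linˡ (+ 1) μ (lookup (lookup A i)) (kronecker i) w ⟩
      + 1 * (lookup (lookup A i) ∙ w) - μ * (kronecker i ∙ w) ≡⟨ cong₂ _-_ (rows i) (cong (μ *_) (kronecker-∙ i w)) ⟩
      μ * w i - μ * w i ≡⟨ ℤₚ.+-inverseʳ (μ * w i) ⟩
      + 0 ∎
    where open ≡-Reasoning

  argmax : ∀ {n} (f : Fin (suc n) → ℕ) → ∃ λ i → ∀ j → f j ≤ f i
  argmax {zero} f = zero , λ { zero → ℕₚ.≤-refl }
  argmax {suc n} f with argmax (f ∘ suc)
  ... | i , max with ℕₚ.≤-total (f zero) (f (suc i))
  ... | inj₁ le = suc i , λ { zero → le ; (suc j) → max j }
  ... | inj₂ ge = zero , λ { zero → ℕₚ.≤-refl ; (suc j) → ℕₚ.≤-trans (max j) ge }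

  -- In the row of the eigenvector's largest coordinate wᵢ, every one of the n terms is at most
  -- k|wᵢ|, and their sum is μwᵢ.
  eigenvalue-bound : ∀ {n k} (A : Mat ℤ n) μ → InM n k A → IsEigenvalue A (toℚ μ) → ∣ μ ∣ ≤ n ℕ.* k
  eigenvalue-bound {zero} A μ bA eig with integer-eigenvector A (toℚ μ) μ (+ 1) (ℚₚ.*-identityˡ (toℚ μ)) eig
  ... | w , (() , _) , rows
  eigenvalue-bound {suc n} {k} A μ bA eig with integer-eigenvector A (toℚ μ) μ (+ 1) (ℚₚ.*-identityˡ (toℚ μ)) eig
  ... | w , (j₀ , w≢0) , rows with argmax (λ i → ∣ w i ∣)
  ... | i , max = ℕₚ.*-cancelʳ-≤ _ _ (∣ w i ∣) {{ℕ.>-nonZero wi>0}} (begin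
      ∣ μ ∣ ℕ.* ∣ w i ∣ ≡⟨ sym (ℤₚ.abs-* μ (w i)) ⟩
      ∣ μ * w i ∣ ≡⟨ cong ∣_∣ (sym (rows i)) ⟩
      ∣ + 1 * (lookup (lookup A i) ∙ w) ∣ ≡⟨ cong ∣_∣ (ℤₚ.*-identityˡ (lookup (lookup A i) ∙ w)) ⟩
      ∣ lookup (lookup A i) ∙ w ∣
        ≤⟨ ∣∙∣≤ (lookup (lookup A i)) w (λ j → InI⇒∣∣≤ (VAllₚ.lookup⁺ (VAllₚ.lookup⁺ bA i) j)) max ⟩
      suc n ℕ.* (k ℕ.* ∣ w i ∣) ≡⟨ sym (ℕₚ.*-assoc (suc n) k (∣ w i ∣)) ⟩
      suc n ℕ.* k ℕ.* ∣ w i ∣ ∎)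
    where
    open ℕₚ.≤-Reasoning
    wi>0 : 0 ℕ.< ∣ w i ∣
    wi>0 = ℕₚ.<-≤-trans (ℕₚ.n≢0⇒n>0 (w≢0 ∘ ℤₚ.∣i∣≡0⇒i≡0)) (max j₀)

  -- Every coordinate of an integral eigenvector is divisible by the denominator b of the eigenvalue, and the quotients
  -- form an eigenvector again.
  denominator-one : ∀ {n} (A : Mat ℤ n) a b → 1 ≤ b → Coprime ∣ a ∣ b → (w : Fin n → ℤ) → ∀ i₀ → w i₀ ≢ + 0 →
    (∀ i → + b * (lookup (lookup A i) ∙ w) ≡ a * w i) → b ≡ 1
  denominator-one A a 1 _ _ _ _ _ _ = refl
  denominator-one {n} A a b@(suc (suc _)) _ coprime w₀ i₀ w₀≢0 rows₀ =
    contradiction rows₀ (<-rec P descend ∣ w₀ i₀ ∣ w₀ refl w₀≢0)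
    where
    -- The descent watches one fixed nonzero coordinate, whose absolute value shrinks strictly on
    -- division by b ≥ 2.
    P : ℕ → Set
    P s = ∀ w → ∣ w i₀ ∣ ≡ s → w i₀ ≢ + 0 → ¬ (∀ i → + b * (lookup (lookup A i) ∙ w) ≡ a * w i)
    descend : ∀ s → (∀ {t} → t ℕ.< s → P t) → P s
    descend s rec w refl w≢0 rows = rec smaller w′ refl w′≢0 rows′
      where
      b∣w : ∀ i → b ℕ∣.∣ ∣ w i ∣
      b∣w i = coprime-divisor (Coprime.sym coprime) (ℕ∣.divides ∣ lookup (lookup A i) ∙ w ∣
        (trans (sym (ℤₚ.abs-* a (w i))) (trans (cong ∣_∣ (sym (rows i)))
        (trans (ℤₚ.abs-* (+ b) (lookup (lookup A i) ∙ w)) (ℕₚ.*-comm b (∣ lookup (lookup A i) ∙ w ∣))))))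
      quotient : ∀ i → ∃ λ q → w i ≡ + b * q
      quotient i with ∣ᵤ⇒∣ {+ b} {w i} (b∣w i)
      ... | divides q eq = q , trans eq (ℤₚ.*-comm q (+ b))
      w′ : Fin n → ℤ
      w′ i = proj₁ (quotient i)
      w≡bw′ : ∀ i → w i ≡ + b * w′ i
      w≡bw′ i = proj₂ (quotient i)
      w′≢0 : w′ i₀ ≢ + 0
      w′≢0 eq = w≢0 (trans (w≡bw′ i₀) (trans (cong (+ b *_) eq) (ℤₚ.*-zeroʳ (+ b))))
      smaller : ∣ w′ i₀ ∣ ℕ.< ∣ w i₀ ∣
      smaller = subst (∣ w′ i₀ ∣ ℕ.<_) (sym (trans (cong ∣_∣ (w≡bw′ i₀)) (trans (ℤₚ.abs-* (+ b) (w′ i₀)) (ℕₚ.*-comm b ∣ w′ i₀ ∣))))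
        (ℕₚ.m<m*n ∣ w′ i₀ ∣ b {{ℕ.≢-nonZero (w′≢0 ∘ ℤₚ.∣i∣≡0⇒i≡0)}} (s≤s (s≤s z≤n)))
      swap : ∀ a b w → a * (b * w) ≡ b * (a * w)
      swap = solve-∀
      rows′ : ∀ i → + b * (lookup (lookup A i) ∙ w′) ≡ a * w′ i
      rows′ i = *-cancelˡ-≢0 (+ b) (λ ()) (begin
        + b * (+ b * (lookup (lookup A i) ∙ w′)) ≡⟨ cong (+ b *_) (sym (∙-scaleʳ (+ b) (lookup (lookup A i)) w′)) ⟩
        + b * (lookup (lookup A i) ∙ (λ j → + b * w′ j))
          ≡⟨ cong (+ b *_) (sum-cong-≗ λ j → cong (lookup (lookup A i) j *_) (sym (w≡bw′ j))) ⟩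
        + b * (lookup (lookup A i) ∙ w) ≡⟨ rows i ⟩
        a * w i ≡⟨ cong (a *_) (w≡bw′ i) ⟩
        a * (+ b * w′ i) ≡⟨ swap a (+ b) (w′ i) ⟩
        + b * (a * w′ i) ∎)
        where open ≡-Reasoning

  rational-eigenvalue⇒integer : ∀ {n} (A : Mat ℤ n) r → IsEigenvalue A r → HasIntEigenvalue A
  rational-eigenvalue⇒integer A r@(mkℚ a d-1 coprime) eig with integer-eigenvector A r a (↧ r) (toℚ-↧ r) eig
  ... | w , (i₀ , w≢0) , rows = a , subst (IsEigenvalue A) r≡a eig
    where
    ↧r≡1 : ↧ₙ r ≡ 1
    ↧r≡1 = denominator-one A a (↧ₙ r) (s≤s z≤n) (Coprime.recompute coprime) w i₀ w≢0 rows
    r≡a : r ≡ toℚ a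
    r≡a = trans (sym (ℚₚ.↥p/↧p≡p r)) (ℚₚ./-cong {↥ r} {↧ₙ r} {a} {1} refl ↧r≡1)

  dotℚ-sum : ∀ {n} (u v : Vec ℚ n) → dotℚ u v ≡ ℚΣ.sum λ j → lookup u j ℚ.* lookup v j
  dotℚ-sum [] [] = refl
  dotℚ-sum (x ∷ u) (y ∷ v) = cong (x ℚ.* y ℚ.+_) (dotℚ-sum u v)

  entry : ∀ {n} → Mat ℚ n → Fin n → Fin n → ℚ
  entry M i j = lookup (lookup M i) j

  entry-tabulate : ∀ {n} (f : Fin n → Fin n → ℚ) i j → entry (tabulate λ i → tabulate (f i)) i j ≡ f i j
  entry-tabulate f i j = trans (cong (λ r → lookup r j) (Vecₚ.lookup∘tabulate (λ i → tabulate (f i)) i)) (Vecₚ.lookup∘tabulate (f i) j)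

  entry-·ₘ : ∀ {n} (M N : Mat ℚ n) i j → entry (M ·ₘ N) i j ≡ ℚΣ.sum λ l → entry M i l ℚ.* entry N l j
  entry-·ₘ M N i j = trans (entry-tabulate _ i j) (trans (dotℚ-sum (lookup M i) _)
    (ℚΣ.sum-cong-≗ λ l → cong (entry M i l ℚ.*_) (Vecₚ.lookup∘tabulate (λ l → entry N l j) l)))

  private
    -- The right side is the function local to `diagℚ`; inferring it lets a later `with` on the
    -- index comparison reduce it.
    entry-diag : ∀ {n} (d : Vec ℚ n) i j → entry (diagℚ d) i j ≡ _
    entry-diag d i j = entry-tabulate _ i j

  entry-diag-≡ : ∀ {n} (d : Vec ℚ n) i → entry (diagℚ d) i i ≡ lookup d i
  entry-diag-≡ d i with i Fin.≟ i | entry-diag d i i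
  ... | yes _ | eq = eq
  ... | no i≢i | _ = contradiction refl i≢i

  entry-diag-≢ : ∀ {n} (d : Vec ℚ n) {i j} → i ≢ j → entry (diagℚ d) i j ≡ 0ℚ
  entry-diag-≢ d {i} {j} i≢j with i Fin.≟ j | entry-diag d i j
  ... | yes i≡j | _ = contradiction i≡j i≢j
  ... | no _ | eq = eq

  sum-zeros : ∀ {n} (t : Fin n → ℚ) → (∀ j → t j ≡ 0ℚ) → ℚΣ.sum t ≡ 0ℚ
  sum-zeros {n} t eq = trans (ℚΣ.sum-cong-≗ eq) (ℚΣ.sum-replicate-zero n)

  sum-single : ∀ {n} (t : Fin n → ℚ) i → (∀ j → i ≢ j → t j ≡ 0ℚ) → ℚΣ.sum t ≡ t i
  sum-single t zero eq = trans (cong (t zero ℚ.+_) (sum-zeros (t ∘ suc) λ j → eq (suc j) λ ())) (ℚₚ.+-identityʳ (t zero))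
  sum-single t (suc i) eq = trans (cong₂ ℚ._+_ (eq zero λ ()) (sum-single (t ∘ suc) i λ j i≢j → eq (suc j) λ { refl → i≢j refl }))
    (ℚₚ.+-identityˡ (t (suc i)))

  -- The first column c of P is an eigenvector: Ac = P(QAc), and QAc is the first column of the
  -- diagonal matrix, so Ac = d₀c. It is nonzero because Qc is the first unit vector.
  diagonalizable⇒eigenvalue : ∀ {n} (A : Mat ℤ (suc n)) → DiagonalizableQ A → HasIntEigenvalue A
  diagonalizable⇒eigenvalue {n} A (P , Q , d , PQ≡I , QP≡I , QAP≡d) =
      rational-eigenvalue⇒integer A d₀ (tabulate c , c≢0 , vec-ext λ i → begin
        lookup (toℚMat A ·ᵥ tabulate c) i ≡⟨ Vecₚ.lookup-map i (λ row → dotℚ row (tabulate c)) (toℚMat A) ⟩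
        dotℚ (lookup (toℚMat A) i) (tabulate c)
          ≡⟨ sym (entry-tabulate (λ i j → dotℚ (lookup (toℚMat A) i) (tabulate λ l → entry P l j)) i zero) ⟩
        y i ≡⟨ Ac≡dc i ⟩
        d₀ ℚ.* c i ≡⟨ cong (d₀ ℚ.*_) (sym (Vecₚ.lookup∘tabulate c i)) ⟩
        d₀ ℚ.* lookup (tabulate c) i ≡⟨ sym (Vecₚ.lookup-map i (d₀ ℚ.*_) (tabulate c)) ⟩
        lookup (Vec.map (d₀ ℚ.*_) (tabulate c)) i ∎)
    where
    open ≡-Reasoning
    d₀ = lookup d zero
    c y : Fin (suc n) → ℚ
    c l = entry P l zero
    y i = entry (toℚMat A ·ₘ P) i zero

    Qy : ∀ l → (ℚΣ.sum λ j → entry Q l j ℚ.* y j) ≡ entry (diagℚ d) l zero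
    Qy l = trans (sym (entry-·ₘ Q (toℚMat A ·ₘ P) l zero)) (cong (λ M → entry M l zero) QAP≡d)

    I-≡ : ∀ i → entry {suc n} Iℚ i i ≡ 1ℚ
    I-≡ i = trans (entry-diag-≡ (replicate _ 1ℚ) i) (Vecₚ.lookup-replicate i 1ℚ)

    Ac≡dc : ∀ i → y i ≡ d₀ ℚ.* c i
    Ac≡dc i = begin
      y i ≡⟨ sym (trans (cong (ℚ._* y i) (I-≡ i)) (ℚₚ.*-identityˡ (y i))) ⟩
      entry Iℚ i i ℚ.* y i
        ≡⟨ sym (sum-single (λ j → entry Iℚ i j ℚ.* y j) i λ j i≢j → trans (cong (ℚ._* y j) (entry-diag-≢ (replicate _ 1ℚ) i≢j)) (ℚₚ.*-zeroˡ (y j))) ⟩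
      (ℚΣ.sum λ j → entry Iℚ i j ℚ.* y j) ≡⟨ ℚΣ.sum-cong-≗ (λ j → cong (λ M → entry M i j ℚ.* y j) (sym PQ≡I)) ⟩
      (ℚΣ.sum λ j → entry (P ·ₘ Q) i j ℚ.* y j)
        ≡⟨ ℚΣ.sum-cong-≗ (λ j → trans (cong (ℚ._* y j) (entry-·ₘ P Q i j)) (ℚΣ.*-distribʳ-sum (y j) (λ l → entry P i l ℚ.* entry Q l j))) ⟩
      (ℚΣ.sum λ j → ℚΣ.sum λ l → entry P i l ℚ.* entry Q l j ℚ.* y j)
        ≡⟨ ℚΣ.∑-comm (λ j l → entry P i l ℚ.* entry Q l j ℚ.* y j) ⟩
      (ℚΣ.sum λ l → ℚΣ.sum λ j → entry P i l ℚ.* entry Q l j ℚ.* y j) ≡⟨ ℚΣ.sum-cong-≗ (λ l → trans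
          (ℚΣ.sum-cong-≗ λ j → ℚₚ.*-assoc (entry P i l) (entry Q l j) (y j)) (sym (ℚΣ.*-distribˡ-sum (entry P i l) (λ j → entry Q l j ℚ.* y j)))) ⟩
      (ℚΣ.sum λ l → entry P i l ℚ.* (ℚΣ.sum λ j → entry Q l j ℚ.* y j))
        ≡⟨ ℚΣ.sum-cong-≗ (λ l → cong (entry P i l ℚ.*_) (Qy l)) ⟩
      (ℚΣ.sum λ l → entry P i l ℚ.* entry (diagℚ d) l zero)
        ≡⟨ sum-single _ zero (λ l 0≢l → trans (cong (entry P i l ℚ.*_) (entry-diag-≢ d (0≢l ∘ sym))) (ℚₚ.*-zeroʳ (entry P i l))) ⟩
      c i ℚ.* entry (diagℚ d) zero zero ≡⟨ cong (c i ℚ.*_) (entry-diag-≡ d zero) ⟩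
      c i ℚ.* d₀ ≡⟨ ℚₚ.*-comm (c i) d₀ ⟩
      d₀ ℚ.* c i ∎

    c≢0 : tabulate c ≢ replicate (suc n) 0ℚ
    c≢0 c≡0 = contradiction 0≡1 λ ()
      where
      0≡1 : 0ℚ ≡ 1ℚ
      0≡1 = begin
        0ℚ ≡⟨ sym (sum-zeros _ λ l → trans (cong (entry Q zero l ℚ.*_) (trans (sym (Vecₚ.lookup∘tabulate c l))
               (trans (cong (λ u → lookup u l) c≡0) (Vecₚ.lookup-replicate l 0ℚ)))) (ℚₚ.*-zeroʳ (entry Q zero l))) ⟩
        (ℚΣ.sum λ l → entry Q zero l ℚ.* c l) ≡⟨ sym (entry-·ₘ Q P zero zero) ⟩
        entry (Q ·ₘ P) zero zero ≡⟨ cong (λ M → entry M zero zero) QP≡I ⟩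
        entry {suc n} Iℚ zero zero ≡⟨ I-≡ zero ⟩
        1ℚ ∎

open RationalEigenvalues

-- Summation over all eigenvalues

open import Data.Nat using (_+_; _*_; _^_)
open import Data.Integer using (∣_∣)
open import Data.List using (List; length)
open import Data.List.Relation.Unary.All as All using (All)
open import Data.List.Relation.Unary.Unique.Propositional using (Unique)
open import Data.Nat.Tactic.RingSolver using (solve-∀)
open ℕₚ

theorem1 : (n : ℕ) → 2 ≤ n → (p q : ℕ) → 1 ≤ p → 1 ≤ q →
    Σ ℕ λ C → 1 ≤ C ×
    ((k : ℕ) → 1 ≤ k → (L : List (Mat ℤ n)) → Unique L →
    All (λ A → InM n k A × HasIntEigenvalue A) L →
    (length L * k) ^ q ≤ C ^ q * k ^ p * (1 + 2 * k) ^ (n * n * q)) ×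
    ((k : ℕ) → 1 ≤ k → (L : List (Mat ℤ n)) → Unique L →
    All (λ A → InM n k A × DiagonalizableQ A) L →
    (length L * k) ^ q ≤ C ^ q * k ^ p * (1 + 2 * k) ^ (n * n * q))
-- The second `n` is ℓ, in accordance with the bound |μ| ≤ nk.
theorem1 n@(suc _) 2≤n p q 1≤p 1≤q with eigen-codimTwo p q 1≤p 1≤q n n 2≤n
... | C₀ , bound = C , s≤s z≤n , integral ,
      λ k 1≤k L u ps → integral k 1≤k L u (All.map (λ { {A} (bA , dg) → bA , diagonalizable⇒eigenvalue A dg }) ps)
  where
  -- The successor keeps the constant positive even if `C₀` is 0.
  C = suc (n * C₀)
  integral : (k : ℕ) → 1 ≤ k → (L : List (Mat ℤ n)) → Unique L →
    All (λ A → InM n k A × HasIntEigenvalue A) L →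
    (length L * k) ^ q ≤ C ^ q * k ^ p * (1 + 2 * k) ^ (n * n * q)
  integral k 1≤k L u ps with bound k 1≤k
  ... | countBound G N small N≤ count = begin
      (length L * k) ^ q ≤⟨ ^-monoˡ-≤ q linear ⟩
      (n * (G * K ^ (n * n))) ^ q
        ≡⟨ trans (^-distribʳ-* n (G * K ^ (n * n)) q) (cong (n ^ q *_) (^-distribʳ-* G (K ^ (n * n)) q)) ⟩
      n ^ q * (G ^ q * (K ^ (n * n)) ^ q) ≤⟨ *-monoʳ-≤ (n ^ q) (*-mono-≤ small (≤-reflexive (^-*-assoc K (n * n) q))) ⟩
      n ^ q * (C₀ ^ q * k ^ p * K ^ (n * n * q)) ≡⟨ reassoc (n ^ q) (C₀ ^ q) (k ^ p) (K ^ (n * n * q)) ⟩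
      n ^ q * C₀ ^ q * k ^ p * K ^ (n * n * q) ≡⟨ cong (λ t → t * k ^ p * K ^ (n * n * q)) (sym (^-distribʳ-* n C₀ q)) ⟩
      (n * C₀) ^ q * k ^ p * K ^ (n * n * q)
        ≤⟨ *-monoˡ-≤ (K ^ (n * n * q)) (*-monoˡ-≤ (k ^ p) (^-monoˡ-≤ q (n≤1+n (n * C₀)))) ⟩
      C ^ q * k ^ p * K ^ (n * n * q) ∎
    where
    open ≤-Reasoning
    K = 1 + 2 * k
    reassoc : ∀ a b c d → a * (b * c * d) ≡ a * b * c * d
    reassoc = solve-∀
    -- With the bound on μ as part of the predicate, an out-of-range μ contributes the empty set and
    -- the estimate holds for every integer μ.
    fixed : ∀ μ → (λ A → ∣ μ ∣ ≤ n * k × Eigen n k μ A) ≲ N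
    fixed μ with ∣ μ ∣ ≤? n * k
    ... | yes ∣μ∣≤ = ≲-mono proj₂ ≤-refl (count μ ∣μ∣≤)
    ... | no ∣μ∣≰ = ≲-mono (λ e → e) z≤n (≲-none λ { (∣μ∣≤ , _) → ∣μ∣≰ ∣μ∣≤ })
    len : length L ≤ length (interval (n * k)) * N
    len = ≲-⋃ (interval (n * k))
      (λ { {A} (bA , μ , eig) → let ∣μ∣≤ = eigenvalue-bound A μ bA eig in
           μ , InI⇒∈interval (∣∣≤⇒InI ∣μ∣≤) , ∣μ∣≤ , bA , integer-eigenvalue A μ eig })
      (λ {μ} _ → fixed μ) L u ps
    expand : ∀ n k → n * (1 + 2 * k) ≡ n + 2 * (n * k)
    expand = solve-∀
    regroup : ∀ n K N → n * K * N * K ≡ n * (N * (K * K))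
    regroup = solve-∀
    -- There are at most nK values of μ, and k ≤ K. The two factors K thus produced are the ones
    -- that `N≤` absorbs.
    linear : length L * k ≤ n * (G * K ^ (n * n))
    linear = begin
      length L * k ≤⟨ *-mono-≤ len (≤-trans (m≤m+n k (k + 0)) (n≤1+n (2 * k))) ⟩
      length (interval (n * k)) * N * K ≡⟨ cong (λ l → l * N * K) (length-interval (n * k)) ⟩
      (1 + 2 * (n * k)) * N * K ≤⟨ *-monoˡ-≤ K (*-monoˡ-≤ N (+-monoˡ-≤ (2 * (n * k)) {1} {n} (s≤s z≤n))) ⟩
      (n + 2 * (n * k)) * N * K ≡⟨ cong (λ l → l * N * K) (sym (expand n k)) ⟩
      n * K * N * K ≡⟨ regroup n K N ⟩
      n * (N * (K * K)) ≤⟨ *-monoʳ-≤ n N≤ ⟩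
      n * (G * K ^ (n * n)) ∎
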